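{- Let $n\geq 3$ be an integer, and let $G$ be a triangle-free graph of order $n$ whose complement is connected. Then $$\rho(G)\leq \rho\left(K_{\lceil n/2\rceil,\lfloor n/2\rfloor}-e\right),$$ with equality if and only if $G\cong K_{\lceil n/2\rceil,\lfloor n/2\rfloor}-e$.
   Context: All graphs are finite, simple and undirected. $\rho(G)$ denotes the largest eigenvalue of the adjacency matrix of $G$. $K_{p,q}$ is the complete bipartite graph with part sizes $p$ and $q$, and $K_{p,q}-e$ is the graph obtained from it by deleting one edge (unique up to isomorphism). -}

module Defs where

open import Algebra.Bundles.Raw using (RawSemiring)
open import Algebra.Definitions.RawMonoid using (sum)
open import Data.Bool.Base using (Bool; true; false; T; not; _∧_; _∨_; _xor_; if_then_else_)
open import Data.Bool.Properties using (xor-comm; xor-same; ∧-comm; ∨-comm)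
open import Data.Empty using (⊥-elim)
open import Data.Fin.Base using (Fin; splitAt)
open import Data.Fin.Properties using () renaming (_≟_ to _≟ᶠ_)
open import Data.Nat.Base as ℕ using (ℕ; _⊔_)
import Data.Nat.Properties as ℕ
open import Data.Product.Base using (Σ; _×_; _,_; proj₁; proj₂; ∃-syntax)
open import Data.Rational.Base as ℚ using (ℚ; 0ℚ; 1ℚ; ½; ∣_∣; Positive)
import Data.Rational.Properties as ℚ
open import Data.Rational.Solver using (module +-*-Solver)
open import Data.Sum.Base using ([_,_]′)
open import Data.Vec.Functional using (Vector)
open import Function.Bundles using (_↔_; Inverse)
open import Function.Base using (it)
open import Level using (0ℓ)
open import Relation.Binary.Construct.Closure.ReflexiveTransitive using (Star)
open import Relation.Binary.PropositionalEquality
  using (_≡_; refl; sym; trans; cong; cong₂; subst)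
open import Relation.Nullary.Decidable using (⌊_⌋; yes; no)
open import Relation.Nullary.Negation using (¬_)

------------------------------------------------------------------------
-- Real numbers: Cauchy sequences of rationals, with the setoid equality
-- "the difference tends to 0".

IsCauchy : (ℕ → ℚ) → Set
IsCauchy x = ∀ ε → .{{Positive ε}} →
  ∃[ N ] (∀ m n → N ℕ.≤ m → N ℕ.≤ n → ∣ x m ℚ.- x n ∣ ℚ.< ε)

record ℝ : Set where
  constructor mkℝ
  field
    seq    : ℕ → ℚ
    cauchy : IsCauchy seq

open ℝ public

infix 4 _≃_ _<ℝ_ _≤ℝ_

_≃_ : ℝ → ℝ → Set
x ≃ y = ∀ ε → .{{Positive ε}} →
  ∃[ N ] (∀ n → N ℕ.≤ n → ∣ seq x n ℚ.- seq y n ∣ ℚ.< ε)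

-- The rational gap ε is needed: termwise strict inequality survives
-- in the limit only as ≤.
_<ℝ_ : ℝ → ℝ → Set
x <ℝ y = Σ ℚ λ ε → Positive ε ×
  ∃[ N ] (∀ n → N ℕ.≤ n → seq x n ℚ.+ ε ℚ.≤ seq y n)

_≤ℝ_ : ℝ → ℝ → Set
x ≤ℝ y = ¬ (y <ℝ x)

constant-cauchy : ∀ q → IsCauchy (λ _ → q)
constant-cauchy q ε = 0 , λ _ _ _ _ →
  subst (ℚ._< ε) (sym (cong ∣_∣ (ℚ.+-inverseʳ q))) (ℚ.positive⁻¹ ε)

half-pos : ∀ ε → .{{Positive ε}} → Positive (½ ℚ.* ε)
half-pos ε = ℚ.pos*pos⇒pos ½ ε

halves : ∀ ε → ½ ℚ.* ε ℚ.+ ½ ℚ.* ε ≡ ε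
halves ε = trans (sym (ℚ.*-distribʳ-+ ε ½ ½)) (ℚ.*-identityˡ ε)

+-cauchy : ∀ {x y} → IsCauchy x → IsCauchy y → IsCauchy (λ n → x n ℚ.+ y n)
+-cauchy {x} {y} cx cy ε = Nx ⊔ Ny , bound
  where
  Cx = cx (½ ℚ.* ε) {{half-pos ε}}
  Cy = cy (½ ℚ.* ε) {{half-pos ε}}
  Nx = proj₁ Cx
  Ny = proj₁ Cy

  rearrange : ∀ a b c d → (a ℚ.+ b) ℚ.- (c ℚ.+ d) ≡ (a ℚ.- c) ℚ.+ (b ℚ.- d)
  rearrange = solve 4 (λ a b c d → (a :+ b) :- (c :+ d) := (a :- c) :+ (b :- d)) refl
    where open +-*-Solver

  bound : ∀ m n → Nx ⊔ Ny ℕ.≤ m → Nx ⊔ Ny ℕ.≤ n →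
    ∣ (x m ℚ.+ y m) ℚ.- (x n ℚ.+ y n) ∣ ℚ.< ε
  bound m n pm pn = begin-strict
    ∣ (x m ℚ.+ y m) ℚ.- (x n ℚ.+ y n) ∣   ≡⟨ cong ∣_∣ (rearrange (x m) (y m) (x n) (y n)) ⟩
    ∣ (x m ℚ.- x n) ℚ.+ (y m ℚ.- y n) ∣   ≤⟨ ℚ.∣p+q∣≤∣p∣+∣q∣ (x m ℚ.- x n) (y m ℚ.- y n) ⟩
    ∣ x m ℚ.- x n ∣ ℚ.+ ∣ y m ℚ.- y n ∣   <⟨ ℚ.+-mono-<
        (proj₂ Cx m n (ℕ.m⊔n≤o⇒m≤o Nx Ny pm) (ℕ.m⊔n≤o⇒m≤o Nx Ny pn))
        (proj₂ Cy m n (ℕ.m⊔n≤o⇒n≤o Nx Ny pm) (ℕ.m⊔n≤o⇒n≤o Nx Ny pn)) ⟩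
    ½ ℚ.* ε ℚ.+ ½ ℚ.* ε                   ≡⟨ halves ε ⟩
    ε                                     ∎
    where open ℚ.≤-Reasoning

EventuallyBounded : (ℕ → ℚ) → Set
EventuallyBounded x = ∃[ B ] Positive B × ∃[ N ] (∀ n → N ℕ.≤ n → ∣ x n ∣ ℚ.≤ B)

eventually-bounded : ∀ {x} → IsCauchy x → EventuallyBounded x
eventually-bounded {x} cx = B , posB , N , bound
  where
  N = proj₁ (cx 1ℚ)
  B = 1ℚ ℚ.+ ∣ x N ∣

  posB : Positive B
  posB = ℚ.pos+nonNeg⇒pos 1ℚ ∣ x N ∣ {{ℚ.∣-∣-nonNeg (x N)}}

  split : ∀ a b → a ≡ (a ℚ.- b) ℚ.+ b
  split = solve 2 (λ a b → a := (a :- b) :+ b) refl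
    where open +-*-Solver

  bound : ∀ n → N ℕ.≤ n → ∣ x n ∣ ℚ.≤ B
  bound n p = begin
    ∣ x n ∣                         ≡⟨ cong ∣_∣ (split (x n) (x N)) ⟩
    ∣ (x n ℚ.- x N) ℚ.+ x N ∣       ≤⟨ ℚ.∣p+q∣≤∣p∣+∣q∣ (x n ℚ.- x N) (x N) ⟩
    ∣ x n ℚ.- x N ∣ ℚ.+ ∣ x N ∣     ≤⟨ ℚ.+-monoˡ-≤ ∣ x N ∣
                                         (ℚ.<⇒≤ (proj₂ (cx 1ℚ) n N p ℕ.≤-refl)) ⟩
    B                               ∎
    where open ℚ.≤-Reasoning

divide : ∀ ε B → .{{Positive ε}} → .{{Positive B}} → ∃[ δ ] Positive δ × B ℚ.* δ ≡ ε
divide ε B {{posε}} {{posB}} = 1/B ℚ.* ε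
  , ℚ.pos*pos⇒pos 1/B {{ℚ.1/pos⇒pos B}} ε
  , trans (sym (ℚ.*-assoc B 1/B ε))
   (trans (cong (ℚ._* ε) (ℚ.*-inverseʳ B {{ℚ.pos⇒nonZero B}})) (ℚ.*-identityˡ ε))
  where 1/B = (ℚ.1/ B) {{ℚ.pos⇒nonZero B}}

product< : ∀ B δ a b → .{{Positive B}} → ∣ a ∣ ℚ.≤ B → ∣ b ∣ ℚ.< δ → ∣ a ℚ.* b ∣ ℚ.< B ℚ.* δ
product< B δ a b a≤B b<δ = begin-strict
  ∣ a ℚ.* b ∣       ≡⟨ ℚ.∣p*q∣≡∣p∣*∣q∣ a b ⟩
  ∣ a ∣ ℚ.* ∣ b ∣   ≤⟨ ℚ.*-monoʳ-≤-nonNeg ∣ b ∣ {{ℚ.∣-∣-nonNeg b}} a≤B ⟩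
  B ℚ.* ∣ b ∣       <⟨ ℚ.*-monoʳ-<-pos B b<δ ⟩
  B ℚ.* δ           ∎
  where open ℚ.≤-Reasoning

products-close : ∀ B C δ a b c d → .{{Positive B}} → .{{Positive C}} →
  ∣ a ∣ ℚ.≤ B → ∣ d ∣ ℚ.≤ C → ∣ a ℚ.- c ∣ ℚ.< δ → ∣ b ℚ.- d ∣ ℚ.< δ →
  ∣ a ℚ.* b ℚ.- c ℚ.* d ∣ ℚ.< (B ℚ.+ C) ℚ.* δ
products-close B C δ a b c d a≤B d≤C a-c<δ b-d<δ = begin-strict
  ∣ a ℚ.* b ℚ.- c ℚ.* d ∣
    ≡⟨ cong ∣_∣ (rearrange a b c d) ⟩
  ∣ a ℚ.* (b ℚ.- d) ℚ.+ d ℚ.* (a ℚ.- c) ∣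
    ≤⟨ ℚ.∣p+q∣≤∣p∣+∣q∣ (a ℚ.* (b ℚ.- d)) (d ℚ.* (a ℚ.- c)) ⟩
  ∣ a ℚ.* (b ℚ.- d) ∣ ℚ.+ ∣ d ℚ.* (a ℚ.- c) ∣
    <⟨ ℚ.+-mono-< (product< B δ a (b ℚ.- d) a≤B b-d<δ) (product< C δ d (a ℚ.- c) d≤C a-c<δ) ⟩
  B ℚ.* δ ℚ.+ C ℚ.* δ
    ≡⟨ sym (ℚ.*-distribʳ-+ δ B C) ⟩
  (B ℚ.+ C) ℚ.* δ ∎
  where
  open ℚ.≤-Reasoning
  rearrange : ∀ a b c d →
    a ℚ.* b ℚ.- c ℚ.* d ≡ a ℚ.* (b ℚ.- d) ℚ.+ d ℚ.* (a ℚ.- c)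
  rearrange = solve 4 (λ a b c d →
    a :* b :- c :* d := a :* (b :- d) :+ d :* (a :- c)) refl
    where open +-*-Solver

*-cauchy : ∀ {x y} → IsCauchy x → IsCauchy y → IsCauchy (λ n → x n ℚ.* y n)
*-cauchy {x} {y} cx cy ε = from-bounds (eventually-bounded {x} cx) (eventually-bounded {y} cy)
  where
  Goal = ∃[ N ] (∀ m n → N ℕ.≤ m → N ℕ.≤ n → ∣ x m ℚ.* y m ℚ.- x n ℚ.* y n ∣ ℚ.< ε)

  from-bounds : EventuallyBounded x → EventuallyBounded y → Goal
  from-bounds (Bx , posBx , Nbx , bndx) (By , posBy , Nby , bndy) =
    from-δ (divide ε (Bx ℚ.+ By) {{it}} {{ℚ.pos+pos⇒pos Bx {{posBx}} By {{posBy}}}})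
    where
    from-δ : (∃[ δ ] Positive δ × (Bx ℚ.+ By) ℚ.* δ ≡ ε) → Goal
    from-δ (δ , posδ , Bδ≡ε) = N₁ ⊔ N₂ , bound
      where
      Cx = cx δ {{posδ}}
      Cy = cy δ {{posδ}}
      Ncx = proj₁ Cx
      Ncy = proj₁ Cy
      N₁ = Nbx ⊔ Nby
      N₂ = Ncx ⊔ Ncy

      bound : ∀ m n → N₁ ⊔ N₂ ℕ.≤ m → N₁ ⊔ N₂ ℕ.≤ n →
        ∣ x m ℚ.* y m ℚ.- x n ℚ.* y n ∣ ℚ.< ε
      bound m n pm pn = subst (∣ x m ℚ.* y m ℚ.- x n ℚ.* y n ∣ ℚ.<_) Bδ≡ε
        (products-close Bx By δ (x m) (y m) (x n) (y n) {{posBx}} {{posBy}}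
          (bndx m (ℕ.m⊔n≤o⇒m≤o Nbx Nby (ℕ.m⊔n≤o⇒m≤o N₁ N₂ pm)))
          (bndy n (ℕ.m⊔n≤o⇒n≤o Nbx Nby (ℕ.m⊔n≤o⇒m≤o N₁ N₂ pn)))
          (proj₂ Cx m n (ℕ.m⊔n≤o⇒m≤o Ncx Ncy qm) (ℕ.m⊔n≤o⇒m≤o Ncx Ncy qn))
          (proj₂ Cy m n (ℕ.m⊔n≤o⇒n≤o Ncx Ncy qm) (ℕ.m⊔n≤o⇒n≤o Ncx Ncy qn)))
        where
        qm = ℕ.m⊔n≤o⇒n≤o N₁ N₂ pm
        qn = ℕ.m⊔n≤o⇒n≤o N₁ N₂ pn

fromℚ : ℚ → ℝ
fromℚ q = mkℝ (λ _ → q) (constant-cauchy q)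

0ℝ 1ℝ : ℝ
0ℝ = fromℚ 0ℚ
1ℝ = fromℚ 1ℚ

infixl 6 _+ℝ_
infixl 7 _*ℝ_

_+ℝ_ : ℝ → ℝ → ℝ
mkℝ x cx +ℝ mkℝ y cy = mkℝ (λ n → x n ℚ.+ y n) (+-cauchy {x} {y} cx cy)

_*ℝ_ : ℝ → ℝ → ℝ
mkℝ x cx *ℝ mkℝ y cy = mkℝ (λ n → x n ℚ.* y n) (*-cauchy {x} {y} cx cy)

ℝ-rawSemiring : RawSemiring 0ℓ 0ℓ
ℝ-rawSemiring = record
  { Carrier = ℝ ; _≈_ = _≃_ ; _+_ = _+ℝ_ ; _*_ = _*ℝ_ ; 0# = 0ℝ ; 1# = 1ℝ }

------------------------------------------------------------------------
-- Eigenvalues of real square matrices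

Matrix : ℕ → Set
Matrix n = Fin n → Fin n → ℝ

_·_ : ∀ {n} → Matrix n → Vector ℝ n → Vector ℝ n
(M · x) i = sum (RawSemiring.+-rawMonoid ℝ-rawSemiring) (λ j → M i j *ℝ x j)

IsEigenvalue : ∀ {n} → Matrix n → ℝ → Set
IsEigenvalue {n} M r = Σ (Vector ℝ n) λ x →
  ¬ (∀ i → x i ≃ 0ℝ) × (∀ i → (M · x) i ≃ r *ℝ x i)

IsLargestEigenvalue : ∀ {n} → Matrix n → ℝ → Set
IsLargestEigenvalue M r = IsEigenvalue M r × (∀ s → IsEigenvalue M s → s ≤ℝ r)

------------------------------------------------------------------------
-- Finite simple graphs of order n, on the vertex set Fin n

record Graph (n : ℕ) : Set where
  field
    adj        : Fin n → Fin n → Bool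
    adj-sym    : ∀ i j → adj i j ≡ adj j i
    adj-irrefl : ∀ i → adj i i ≡ false

open Graph public

Adj : ∀ {n} → Graph n → Fin n → Fin n → Set
Adj G i j = T (adj G i j)

TriangleFree : ∀ {n} → Graph n → Set
TriangleFree G = ∀ i j k → ¬ (Adj G i j × Adj G j k × Adj G i k)

-- Any two vertices are joined by a walk; the order-0 graph also satisfies this.
Connected : ∀ {n} → Graph n → Set
Connected G = ∀ i j → Star (Adj G) i j

infix 4 _≅_

_≅_ : ∀ {m n} → Graph m → Graph n → Set
_≅_ {m} {n} G H = Σ (Fin m ↔ Fin n) λ f →
  ∀ i j → adj G i j ≡ adj H (Inverse.to f i) (Inverse.to f j)

adjacencyMatrix : ∀ {n} → Graph n → Matrix n
adjacencyMatrix G i j = if adj G i j then 1ℝ else 0ℝ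

-- r = ρ(G)
IsSpectralRadius : ∀ {n} → Graph n → ℝ → Set
IsSpectralRadius G r = IsLargestEigenvalue (adjacencyMatrix G) r

infix 8 _==_

_==_ : ∀ {n} → Fin n → Fin n → Bool
i == j = ⌊ i ≟ᶠ j ⌋

==-sym : ∀ {n} (i j : Fin n) → (i == j) ≡ (j == i)
==-sym i j with i ≟ᶠ j | j ≟ᶠ i
... | yes _ | yes _ = refl
... | no _  | no _  = refl
... | yes p | no q  = ⊥-elim (q (sym p))
... | no p  | yes q = ⊥-elim (p (sym q))

==-refl : ∀ {n} (i : Fin n) → (i == i) ≡ true
==-refl i with i ≟ᶠ i
... | yes _ = refl
... | no p  = ⊥-elim (p refl)

complement : ∀ {n} → Graph n → Graph n
complement G = record
  { adj        = λ i j → not (i == j) ∧ not (adj G i j)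
  ; adj-sym    = λ i j → cong₂ (λ a b → not a ∧ not b) (==-sym i j) (adj-sym G i j)
  ; adj-irrefl = λ i → cong (λ a → not a ∧ not (adj G i i)) (==-refl i)
  }

-- The parts are the first p and the last q elements of Fin (p + q).
completeBipartite : ∀ p q → Graph (p ℕ.+ q)
completeBipartite p q = record
  { adj        = λ i j → inFirst i xor inFirst j
  ; adj-sym    = λ i j → xor-comm (inFirst i) (inFirst j)
  ; adj-irrefl = λ i → xor-same (inFirst i)
  }
  where
  inFirst : Fin (p ℕ.+ q) → Bool
  inFirst i = [ (λ _ → true) , (λ _ → false) ]′ (splitAt p i)

-- Deletes the edge {u, v}; leaves G unchanged if u and v are not adjacent.
deleteEdge : ∀ {n} → Graph n → Fin n → Fin n → Graph n
deleteEdge G u v = record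
  { adj        = λ i j → adj G i j ∧ not ((i == u ∧ j == v) ∨ (i == v ∧ j == u))
  ; adj-sym    = λ i j → cong₂ (λ a b → a ∧ not b) (adj-sym G i j)
      (trans (∨-comm (i == u ∧ j == v) (i == v ∧ j == u))
             (cong₂ _∨_ (∧-comm (i == v) (j == u)) (∧-comm (i == u) (j == v))))
  ; adj-irrefl = λ i → cong (_∧ not ((i == u ∧ i == v) ∨ (i == v ∧ i == u))) (adj-irrefl G i)
  }

{-# OPTIONS --safe #-}

-- For an eigenvector x of eigenvalue r, Cauchy–Schwarz gives r² ∑ x² = ∑ (A x)² ≤ ∑ sᵢ xᵢ², where
-- sᵢ is the number of walks of length 2 from i. If G is triangle-free, N = N(i) is independent, so
-- sᵢ is |N| (n − |N|) minus the number of non-adjacent pairs in N × (V ∖ N), and |N| (n − |N|) ≤ pq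
-- for p = ⌈n/2⌉ and q = ⌊n/2⌋. Connectedness of the complement makes some pair non-adjacent. If for
-- some i there is only one, and |N| (n − |N|) = pq, then G is K_{p,q} − e. Otherwise ρ(G)² ≤ pq − 2.
-- On the other hand ρ(K_{p,q} − e)² is a root μ ≥ 1 of
--   μ² − (pq − 1) μ + (p − 1)(q − 1) = (μ − 1)(μ − (pq − 2)) − (n − 3),
-- hence exceeds pq − 2. Since being the largest eigenvalue only bounds eigenvalues already at hand,
-- this root is constructed, by bisection, together with an eigenvector.

module Submission where

open import Defs
open import Algebra.Bundles using (CommutativeRing)
open import Algebra.Bundles.Raw using (RawSemiring)
import Algebra.Definitions.RawMonoid
import Algebra.Properties.CommutativeMonoid.Sum
import Algebra.Properties.Semiring.Sum
open import Data.Bool.Base using (Bool; true; false; T; not; _∧_; _∨_; _xor_; if_then_else_)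
import Data.Bool.Properties as Bool
open import Data.Fin.Base using (Fin; zero; suc; fromℕ<; punchIn; splitAt)
open import Data.Fin.Permutation as Perm
  using (Permutation; insert; insert-punchIn; _⟨$⟩ʳ_; _⟨$⟩ˡ_; inverseʳ)
open import Data.Fin.Properties using (all?; punchInᵢ≢i; ¬∀⟶∃¬) renaming (_≟_ to _≟ᶠ_)
import Data.Integer.Base as ℤ
import Data.Integer.Properties as ℤ
open import Data.Nat.Base
  using (ℕ; zero; suc; _+_; _*_; _≤_; _<_; z≤n; s≤s; _⊔_; ⌈_/2⌉; ⌊_/2⌋)
import Data.Nat.Properties as ℕ
import Data.Nat.Solver
open import Data.Product.Base using (Σ; _×_; _,_; proj₁; proj₂; ∃-syntax)
open import Data.Product.Properties using (≡-dec)
open import Data.Rational.Base as ℚ using (ℚ; 0ℚ; 1ℚ; ½; ∣_∣; Positive; mkℚ)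
import Data.Rational.Properties as ℚ
open import Data.Rational.Solver using (module +-*-Solver)
import Data.Rational.Unnormalised.Base as ℚᵘ
import Data.Rational.Unnormalised.Properties as ℚᵘ
open import Data.Sum.Base as Sum using (_⊎_; inj₁; inj₂; [_,_]′)
open import Data.Vec.Functional using (Vector)
open import Function.Base using (_∘_; it)
open import Function.Bundles using (_⇔_; mk⇔)
open import Function.Construct.Symmetry using (↔-sym)
open import Relation.Binary.Construct.Closure.ReflexiveTransitive as Star using (Star; _◅_)
open import Relation.Binary.Definitions using (DecidableEquality)
open import Relation.Binary.PropositionalEquality
open import Relation.Nullary.Decidable using (Dec; ⌊_⌋; yes; no)
open import Relation.Nullary.Negation using (¬_; contradiction)

-- The obstacle is constructive. The order of two reals cannot be decided, and of an eigenvector it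
-- is only known that not all coordinates vanish, so none can be picked as nonzero. Hence the case
-- split compares natural numbers attached to the graph, and estimates are made on the rational
-- terms of the sequences, where the eigenvector equation holds up to an error tending to 0. The
-- bound on ρ(G) takes this form: if a rational c with c² > M = pq - 2 is eventually below an
-- eigenvalue, every coordinate of its eigenvector tends to 0. No square root of M is formed. Such a
-- c requires a rational gap between M and the square of the constructed root. The identity for (μ -
-- 1)(μ - M) yields it for n > 3, as μ is bounded; for n = 3 the constant n - 3 vanishes and the gap
-- comes from M = 0 and μ ≥ 1. The root is never shown to equal ρ(K_{p,q} - e): it is enough that it
-- is an eigenvalue. Four colours, recording the side of a vertex and whether it is an end of the
-- missing edge, serve twice: equal class sizes give the isomorphism, and the eigenvector is
-- constant on classes.

private
  module ℕΣ = Algebra.Properties.Semiring.Sum ℕ.+-*-semiring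
  module ℕΣ⁺ = Algebra.Properties.CommutativeMonoid.Sum ℕ.+-0-commutativeMonoid
  module ℚΣ = Algebra.Properties.Semiring.Sum (CommutativeRing.semiring ℚ.+-*-commutativeRing)
  module ℚΣ⁺ = Algebra.Properties.CommutativeMonoid.Sum ℚ.+-0-commutativeMonoid

  variable
    n : ℕ

≡⇒T : ∀ {b} → b ≡ true → T b
≡⇒T refl = _

-- Counting

𝟙 : Bool → ℕ
𝟙 b = if b then 1 else 0

count : (Fin n → Bool) → ℕ
count f = ℕΣ.sum (𝟙 ∘ f)

sum-mono : {f g : Fin n → ℕ} → (∀ i → f i ≤ g i) → ℕΣ.sum f ≤ ℕΣ.sum g
sum-mono {zero}  f≤g = z≤n
sum-mono {suc n} f≤g = ℕ.+-mono-≤ (f≤g zero) (sum-mono (f≤g ∘ suc))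

sum-zero : {f : Fin n → ℕ} → (∀ i → f i ≡ 0) → ℕΣ.sum f ≡ 0
sum-zero {n} f≡0 = trans (ℕΣ.sum-cong-≗ f≡0) (ℕΣ.sum-replicate-zero n)

sum-zero⁻¹ : (f : Fin n → ℕ) → ℕΣ.sum f ≡ 0 → ∀ i → f i ≡ 0
sum-zero⁻¹ f Σ≡0 zero    = ℕ.m+n≡0⇒m≡0 (f zero) Σ≡0
sum-zero⁻¹ f Σ≡0 (suc i) = sum-zero⁻¹ (f ∘ suc) (ℕ.m+n≡0⇒n≡0 (f zero) Σ≡0) i

sum-single : (f : Fin n → ℕ) (v : Fin n) → (∀ i → i ≢ v → f i ≡ 0) → ℕΣ.sum f ≡ f v
sum-single {suc n} f v f≡0 = trans (ℕΣ⁺.sum-remove {i = v} f)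
  (trans (cong (f v +_) (sum-zero (λ i → f≡0 (punchIn v i) (punchInᵢ≢i v i)))) (ℕ.+-identityʳ (f v)))

sum-one⁻¹ : (f : Fin n → ℕ) → ℕΣ.sum f ≡ 1 → ∃[ v ] f v ≡ 1 × (∀ i → i ≢ v → f i ≡ 0)
sum-one⁻¹ {suc n} f Σ≡1 with f zero in f0
... | suc m = zero , trans f0 (cong suc m≡0) , λ
      { zero    0≢0 → contradiction refl 0≢0
      ; (suc i) _   → sum-zero⁻¹ (f ∘ suc) (ℕ.m+n≡0⇒n≡0 m (ℕ.suc-injective Σ≡1)) i }
  where
  m≡0 : m ≡ 0
  m≡0 = ℕ.m+n≡0⇒m≡0 m (ℕ.suc-injective Σ≡1)
... | zero with sum-one⁻¹ (f ∘ suc) Σ≡1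
...   | v , fv≡1 , rest = suc v , fv≡1 , λ
      { zero    _    → f0
      ; (suc i) i≢v → rest i (i≢v ∘ cong suc) }

==-≢ : {i v : Fin n} → i ≢ v → (i == v) ≡ false
==-≢ {i = i} {v} i≢v with i ≟ᶠ v
... | yes i≡v = contradiction i≡v i≢v
... | no _    = refl

count-== : (v : Fin n) → count (_== v) ≡ 1
count-== v = trans (sum-single (λ i → 𝟙 (i == v)) v (λ i i≢v → cong 𝟙 (==-≢ i≢v)))
                   (cong 𝟙 (==-refl v))

count-cong : {f g : Fin n → Bool} → (∀ i → f i ≡ g i) → count f ≡ count g
count-cong f≡g = ℕΣ.sum-cong-≗ (cong 𝟙 ∘ f≡g)

count-pos⁻¹ : (f : Fin n → Bool) → 1 ≤ count f → ∃[ i ] f i ≡ true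
count-pos⁻¹ {suc n} f 1≤ with f zero in f0
... | true  = zero , f0
... | false with count-pos⁻¹ (f ∘ suc) 1≤
...   | i , fi = suc i , fi

count-complement : (f : Fin n → Bool) → count f + count (not ∘ f) ≡ n
count-complement {n} f = trans (sym (ℕΣ⁺.∑-distrib-+ (𝟙 ∘ f) (𝟙 ∘ not ∘ f)))
  (trans (ℕΣ.sum-cong-≗ (λ i → one (f i))) (ones n))
  where
  one : ∀ b → 𝟙 b + 𝟙 (not b) ≡ 1
  one true  = refl
  one false = refl
  ones : ∀ n → ℕΣ.sum {n} (λ _ → 1) ≡ n
  ones zero    = refl
  ones (suc n) = cong suc (ones n)

count-three : (f : Fin n → Bool) {a b c : Fin n} → a ≢ b → a ≢ c → b ≢ c →
  f a ≡ true → f b ≡ true → f c ≡ true → 3 ≤ count f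
count-three f {a} {b} {c} a≢b a≢c b≢c fa fb fc = begin
  3                                             ≡⟨ cong₂ _+_ (count-== a) (cong₂ _+_ (count-== b) (count-== c)) ⟨
  count (_== a) + (count (_== b) + count (_== c)) ≡⟨ cong (count (_== a) +_) (ℕΣ⁺.∑-distrib-+ (𝟙 ∘ (_== b)) (𝟙 ∘ (_== c))) ⟨
  count (_== a) + ℕΣ.sum (λ x → 𝟙 (x == b) + 𝟙 (x == c)) ≡⟨ ℕΣ⁺.∑-distrib-+ (𝟙 ∘ (_== a)) (λ x → 𝟙 (x == b) + 𝟙 (x == c)) ⟨
  ℕΣ.sum (λ x → 𝟙 (x == a) + (𝟙 (x == b) + 𝟙 (x == c))) ≤⟨ sum-mono pointwise ⟩
  count f                                       ∎
  where
  open ℕ.≤-Reasoning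
  pointwise : ∀ x → 𝟙 (x == a) + (𝟙 (x == b) + 𝟙 (x == c)) ≤ 𝟙 (f x)
  pointwise x with x ≟ᶠ a | x ≟ᶠ b | x ≟ᶠ c
  ... | yes x≡a  | yes x≡b  | _        = contradiction (trans (sym x≡a) x≡b) a≢b
  ... | yes x≡a  | no _     | yes x≡c  = contradiction (trans (sym x≡a) x≡c) a≢c
  ... | no _     | yes x≡b  | yes x≡c  = contradiction (trans (sym x≡b) x≡c) b≢c
  ... | yes refl | no _     | no _     rewrite fa = ℕ.≤-refl
  ... | no _     | yes refl | no _     rewrite fb = ℕ.≤-refl
  ... | no _     | no _     | yes refl rewrite fc = ℕ.≤-refl
  ... | no _     | no _     | no _     = z≤n

-- Colourings

module _ {C : Set} (_≟_ : DecidableEquality C) where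

  multiplicity : (Fin n → C) → C → ℕ
  multiplicity c γ = count (λ i → ⌊ c i ≟ γ ⌋)

  multiplicity-own : (c : Fin n → C) (i : Fin n) → 1 ≤ multiplicity c (c i)
  multiplicity-own {suc n} c i rewrite ℕΣ⁺.sum-remove {i = i} (λ j → 𝟙 ⌊ c j ≟ c i ⌋)
    with c i ≟ c i
  ... | yes _ = s≤s z≤n
  ... | no ≢  = contradiction refl ≢

  ⌊≟⌋⇒≡ : ∀ {x y} → ⌊ x ≟ y ⌋ ≡ true → x ≡ y
  ⌊≟⌋⇒≡ {x} {y} eq with yes p ← x ≟ y = p

  -- Greedy matching: the first index is sent to any `j` of its colour, which exists because the
  -- multiplicity of `c zero` is positive. Removing both lowers the same multiplicity by one on
  -- either side.
  colour-bijection : ∀ {m n} (c : Fin m → C) (d : Fin n → C) →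
    (∀ γ → multiplicity c γ ≡ multiplicity d γ) →
    Σ (Permutation m n) λ π → ∀ i → c i ≡ d (π ⟨$⟩ʳ i)
  colour-bijection {zero}  {zero}  c d eq = Perm.id , λ ()
  colour-bijection {zero}  {suc n} c d eq =
    contradiction (subst (1 ≤_) (sym (eq (d zero))) (multiplicity-own d zero)) λ ()
  colour-bijection {suc m} {n} c d eq
    with count-pos⁻¹ (λ j → ⌊ d j ≟ c zero ⌋) (subst (1 ≤_) (eq (c zero)) (multiplicity-own c zero))
  colour-bijection {suc m} {suc n} c d eq | j , dj≡ = insert zero j π , agrees
    where
    c0≡dj : c zero ≡ d j
    c0≡dj = sym (⌊≟⌋⇒≡ dj≡)

    eq′ : ∀ γ → multiplicity (c ∘ suc) γ ≡ multiplicity (d ∘ punchIn j) γ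
    eq′ γ = ℕ.+-cancelˡ-≡ (𝟙 ⌊ c zero ≟ γ ⌋) _ _ (trans (eq γ)
      (trans (ℕΣ⁺.sum-remove {i = j} (λ k → 𝟙 ⌊ d k ≟ γ ⌋))
             (cong (λ x → 𝟙 ⌊ x ≟ γ ⌋ + multiplicity (d ∘ punchIn j) γ) (sym c0≡dj))))

    rest = colour-bijection (c ∘ suc) (d ∘ punchIn j) eq′
    π    = proj₁ rest

    agrees : ∀ i → c i ≡ d (insert zero j π ⟨$⟩ʳ i)
    agrees zero    = c0≡dj
    agrees (suc i) = trans (proj₂ rest i) (cong d (sym (insert-punchIn zero j π i)))

-- Complete bipartite graphs with one edge deleted

-- The side of a vertex, and whether it is an end of the deleted edge.
Colour : Set
Colour = Bool × Bool

_≟ᶜ_ : DecidableEquality Colour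
_≟ᶜ_ = ≡-dec Bool._≟_ Bool._≟_

-- Two marked vertices on different sides can only be the two ends of the deleted edge, so the
-- colours alone decide adjacency.
joined : Colour → Colour → Bool
joined (s , m) (t , l) = (s xor t) ∧ not (m ∧ l)

-- A description by colours rather than an isomorphism with a fixed graph: it can be verified both
-- for `G` and for the extremal graph, and the eigenvector is written down from it directly.
record BipartiteMinusEdge (G : Graph n) (a b : ℕ) : Set where
  field
    side        : Fin n → Bool
    left right  : Fin n
    side-left   : side left ≡ true
    side-right  : side right ≡ false
    count-left  : count side ≡ a
    count-right : count (not ∘ side) ≡ b

  colour : Fin n → Colour
  colour i = side i , (i == left) ∨ (i == right)

  field
    adj-joined : ∀ i j → adj G i j ≡ joined (colour i) (colour j)

  private
    #_ : Colour → ℕ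
    #_ = multiplicity _≟ᶜ_ colour

    indicator : Colour → Fin n → ℕ
    indicator γ i = 𝟙 ⌊ colour i ≟ᶜ γ ⌋

  #left-end : # (true , true) ≡ 1
  #left-end = trans (count-cong pointwise) (count-== left)
    where
    pointwise : ∀ i → ⌊ colour i ≟ᶜ (true , true) ⌋ ≡ (i == left)
    pointwise i with i ≟ᶠ left | i ≟ᶠ right
    ... | yes refl | _        rewrite side-left = refl
    ... | no _     | yes refl rewrite side-right = refl
    ... | no _     | no _     with side i
    ...   | true  = refl
    ...   | false = refl

  #right-end : # (false , true) ≡ 1
  #right-end = trans (count-cong pointwise) (count-== right)
    where
    pointwise : ∀ i → ⌊ colour i ≟ᶜ (false , true) ⌋ ≡ (i == right)
    pointwise i with i ≟ᶠ right | i ≟ᶠ left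
    ... | yes refl | yes r≡l = contradiction (trans (sym side-left) (trans (cong side (sym r≡l)) side-right)) λ ()
    ... | yes refl | no _     rewrite side-right = refl
    ... | no _     | yes refl rewrite side-left = refl
    ... | no _     | no _     with side i
    ...   | true  = refl
    ...   | false = refl

  #left-other : suc (# (true , false)) ≡ a
  #left-other = trans (cong (_+ # (true , false)) (sym #left-end))
    (trans (sym (ℕΣ⁺.∑-distrib-+ (indicator (true , true)) (indicator (true , false))))
    (trans (ℕΣ.sum-cong-≗ pointwise) count-left))
    where
    pointwise : ∀ i → indicator (true , true) i + indicator (true , false) i ≡ 𝟙 (side i)
    pointwise i with side i | (i == left) ∨ (i == right)
    ... | true  | true  = refl
    ... | true  | false = refl
    ... | false | true  = refl
    ... | false | false = refl

  #right-other : suc (# (false , false)) ≡ b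
  #right-other = trans (cong (_+ # (false , false)) (sym #right-end))
    (trans (sym (ℕΣ⁺.∑-distrib-+ (indicator (false , true)) (indicator (false , false))))
    (trans (ℕΣ.sum-cong-≗ pointwise) count-right))
    where
    pointwise : ∀ i → indicator (false , true) i + indicator (false , false) i ≡ 𝟙 (not (side i))
    pointwise i with side i | (i == left) ∨ (i == right)
    ... | true  | true  = refl
    ... | true  | false = refl
    ... | false | true  = refl
    ... | false | false = refl

swap-sides : {G : Graph n} {a b : ℕ} → BipartiteMinusEdge G a b → BipartiteMinusEdge G b a
swap-sides B = record
  { side        = not ∘ side
  ; left        = right
  ; right       = left
  ; side-left   = cong not side-right
  ; side-right  = cong not side-left
  ; count-left  = count-right
  ; count-right = trans (count-cong (Bool.not-involutive ∘ side)) count-left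
  ; adj-joined  = λ i j → trans (adj-joined i j) (cong₂ _∧_ (not-xor (side i) (side j))
      (cong₂ (λ x y → not (x ∧ y)) (Bool.∨-comm (i == left) (i == right)) (Bool.∨-comm (j == left) (j == right))))
  }
  where
  open BipartiteMinusEdge B
  not-xor : ∀ s t → s xor t ≡ not s xor not t
  not-xor true  true  = refl
  not-xor true  false = refl
  not-xor false true  = refl
  not-xor false false = refl

-- In both graphs the four colour classes have sizes 1, a - 1, 1 and b - 1, so a colour-preserving
-- bijection exists, and adjacency depends on the colours only.
isomorphic : ∀ {m n a b} {G : Graph m} {H : Graph n} →
  BipartiteMinusEdge G a b → BipartiteMinusEdge H a b → G ≅ H
isomorphic B B′ = proj₁ bijection , λ i j → trans (B.adj-joined i j)
  (trans (cong₂ joined (proj₂ bijection i) (proj₂ bijection j)) (sym (B′.adj-joined _ _)))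
  where
  module B  = BipartiteMinusEdge B
  module B′ = BipartiteMinusEdge B′
  bijection = colour-bijection _≟ᶜ_ B.colour B′.colour λ
    { (true  , true)  → trans B.#left-end (sym B′.#left-end)
    ; (false , true)  → trans B.#right-end (sym B′.#right-end)
    ; (true  , false) → ℕ.suc-injective (trans B.#left-other (sym B′.#left-other))
    ; (false , false) → ℕ.suc-injective (trans B.#right-other (sym B′.#right-other))
    }

module _ (p q : ℕ) where

  private
    inFirst : Fin (p + q) → Bool
    inFirst i = [ (λ _ → true) , (λ _ → false) ]′ (splitAt p i)

  count-first : ∀ p q → count {p + q} (λ i → [ (λ _ → true) , (λ _ → false) ]′ (splitAt p i)) ≡ p
  count-first zero    q = sum-zero {q} (λ _ → refl)
  count-first (suc p) q = cong suc (trans (count-cong (λ i → unfold (splitAt p i))) (count-first p q))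
    where
    unfold : ∀ x → [ (λ _ → true) , (λ _ → false) ]′ (Sum.map₁ suc x) ≡ [ (λ _ → true) , (λ _ → false) ]′ x
    unfold (inj₁ _) = refl
    unfold (inj₂ _) = refl

  count-second : count (not ∘ inFirst) ≡ q
  count-second = ℕ.+-cancelˡ-≡ p _ _
    (trans (cong (_+ count (not ∘ inFirst)) (sym (count-first p q))) (count-complement inFirst))

  deleted : ∀ {l r} → inFirst l ≡ true → inFirst r ≡ false → ∀ i j →
    (inFirst i xor inFirst j) ∧ not ((i == l ∧ j == r) ∨ (i == r ∧ j == l)) ≡
    joined (inFirst i , i == l ∨ i == r) (inFirst j , j == l ∨ j == r)
  deleted {l} {r} fl fr i j with i ≟ᶠ l | i ≟ᶠ r | j ≟ᶠ l | j ≟ᶠ r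
  ... | yes refl | yes l≡r | _ | _ = contradiction (trans (sym fl) (trans (cong inFirst l≡r) fr)) λ ()
  ... | _ | _ | yes refl | yes l≡r = contradiction (trans (sym fl) (trans (cong inFirst l≡r) fr)) λ ()
  ... | yes refl | no _     | yes refl | no _     rewrite fl = refl
  ... | yes refl | no _     | no _     | yes refl = refl
  ... | yes refl | no _     | no _     | no _     = refl
  ... | no _     | yes refl | yes refl | no _     = refl
  ... | no _     | yes refl | no _     | yes refl rewrite fr = refl
  ... | no _     | yes refl | no _     | no _     = refl
  ... | no _     | no _     | yes refl | no _     = refl
  ... | no _     | no _     | no _     | yes refl = refl
  ... | no _     | no _     | no _     | no _     = refl

  bipartiteMinusEdge : ∀ u v → Adj (completeBipartite p q) u v →
    BipartiteMinusEdge (deleteEdge (completeBipartite p q) u v) p q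
  bipartiteMinusEdge u v uv with inFirst u in fu | inFirst v in fv
  ... | true  | false = record
    { side = inFirst ; left = u ; right = v ; side-left = fu ; side-right = fv
    ; count-left = count-first p q ; count-right = count-second
    ; adj-joined = deleted fu fv }
  ... | false | true  = record
    { side = inFirst ; left = v ; right = u ; side-left = fv ; side-right = fu
    ; count-left = count-first p q ; count-right = count-second
    ; adj-joined = λ i j → trans
        (cong (λ x → (inFirst i xor inFirst j) ∧ not x) (Bool.∨-comm (i == u ∧ j == v) _))
        (deleted fv fu i j) }

-- Products of two numbers with a given sum

Halves : ℕ → ℕ → Set
Halves p q = p ≡ q ⊎ p ≡ suc q

halves-of : ∀ n → Halves ⌈ n /2⌉ ⌊ n /2⌋
halves-of 0 = inj₁ refl
halves-of 1 = inj₂ refl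
halves-of (suc (suc n)) = Sum.map (cong suc) (cong suc) (halves-of n)

private
  -- With b = q - t and e = p - q one has a = p + t and a b = p q - t (t + e), so equality forces t
  -- = 0. The case b > q is impossible, since then a + b ≥ 2q + 2 > p + q.
  balanced-≤ : ∀ {p q a b} → Halves p q → a + b ≡ p + q → b ≤ a →
    a * b ≤ p * q × (a * b ≡ p * q → a ≡ p × b ≡ q)
  balanced-≤ {p} {q} {a} {b} h a+b≡p+q b≤a with b ℕ.≤? q
  ... | yes b≤q with ℕ.m≤n⇒∃[o]m+o≡n b≤q
  ...   | t , refl = ℕ.m+n≤o⇒m≤o (a * b) (ℕ.≤-reflexive product) , equal
    where
    a≡p+t : a ≡ p + t
    a≡p+t = ℕ.+-cancelʳ-≡ b a (p + t) (trans a+b≡p+q (solve 3 (λ p b t → p :+ (b :+ t) := p :+ t :+ b) refl p b t))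
      where open Data.Nat.Solver.+-*-Solver

    excess : Halves p (b + t) → Σ ℕ λ e → p ≡ b + t + e
    excess (inj₁ p≡q)   = 0 , trans p≡q (sym (ℕ.+-identityʳ _))
    excess (inj₂ p≡1+q) = 1 , trans p≡1+q (ℕ.+-comm 1 _)

    e = proj₁ (excess h)

    expand : ∀ {a p} b t e → a ≡ p + t → p ≡ b + t + e → a * b + t * (t + e) ≡ p * (b + t)
    expand b t e refl refl = solve 3 (λ b t e →
      (b :+ t :+ e :+ t) :* b :+ t :* (t :+ e) := (b :+ t :+ e) :* (b :+ t)) refl b t e
      where open Data.Nat.Solver.+-*-Solver

    product : a * b + t * (t + e) ≡ p * (b + t)
    product = expand b t e a≡p+t (proj₂ (excess h))

    equal : a * b ≡ p * q → a ≡ p × b ≡ b + t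
    equal ab≡pq = trans a≡p+t (trans (cong (p +_) t≡0) (ℕ.+-identityʳ p))
                , sym (trans (cong (b +_) t≡0) (ℕ.+-identityʳ b))
      where
      tt≡0 : t * (t + e) ≡ 0
      tt≡0 = ℕ.+-cancelˡ-≡ (a * b) _ _ (trans product (trans (sym ab≡pq) (sym (ℕ.+-identityʳ _))))
      t≡0 : t ≡ 0
      t≡0 with ℕ.m*n≡0⇒m≡0∨n≡0 t tt≡0
      ... | inj₁ t≡0   = t≡0
      ... | inj₂ t+e≡0 = ℕ.m+n≡0⇒m≡0 t t+e≡0
  balanced-≤ {p} {q} {a} {b} h a+b≡p+q b≤a | no b≰q =
    contradiction a+b≡p+q (ℕ.>⇒≢ (begin-strict
      p + q             ≤⟨ ℕ.+-monoˡ-≤ q (p≤ h) ⟩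
      suc q + q         <⟨ ℕ.+-monoʳ-< (suc q) (ℕ.n<1+n q) ⟩
      suc q + suc q     ≤⟨ ℕ.+-mono-≤ (ℕ.≤-trans (ℕ.≰⇒> b≰q) b≤a) (ℕ.≰⇒> b≰q) ⟩
      a + b             ∎))
    where
    open ℕ.≤-Reasoning
    p≤ : Halves p q → p ≤ suc q
    p≤ (inj₁ refl) = ℕ.n≤1+n p
    p≤ (inj₂ refl) = ℕ.≤-refl

balanced-product : ∀ {p q a b} → Halves p q → a + b ≡ p + q →
  a * b ≤ p * q × (a * b ≡ p * q → (a ≡ p × b ≡ q) ⊎ (a ≡ q × b ≡ p))
balanced-product {p} {q} {a} {b} h a+b≡p+q with ℕ.≤-total b a
... | inj₁ b≤a = proj₁ r , inj₁ ∘ proj₂ r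
  where r = balanced-≤ h a+b≡p+q b≤a
... | inj₂ a≤b = subst (_≤ p * q) (ℕ.*-comm b a) (proj₁ r)
    , λ ab≡pq → let (b≡p , a≡q) = proj₂ r (trans (ℕ.*-comm b a) ab≡pq) in inj₂ (a≡q , b≡p)
  where r = balanced-≤ h (trans (ℕ.+-comm b a) a+b≡p+q) a≤b

-- Walks of length 2 in triangle-free graphs

degree : Graph n → Fin n → ℕ
degree G i = count (adj G i)

-- The row sums of the square of the adjacency matrix.
twoWalks : Graph n → Fin n → ℕ
twoWalks G i = ℕΣ.sum (λ j → 𝟙 (adj G i j) * degree G j)

only-edge-missing : (G : Graph n) (side : Fin n → Bool) (l r : Fin n) →
  side l ≡ true → side r ≡ false → adj G l r ≡ false →
  (∀ a b → side a ≡ true → side b ≡ true → adj G a b ≡ false) →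
  (∀ a b → side a ≡ false → side b ≡ false → adj G a b ≡ false) →
  (∀ a b → side a ≡ true → side b ≡ false → a ≢ l ⊎ b ≢ r → adj G a b ≡ true) →
  BipartiteMinusEdge G (count side) (count (not ∘ side))
only-edge-missing G side l r sl sr lr within-left within-right between = record
  { side = side ; left = l ; right = r ; side-left = sl ; side-right = sr
  ; count-left = refl ; count-right = refl ; adj-joined = structure }
  where
  across : ∀ a b → side a ≡ true → side b ≡ false →
    adj G a b ≡ not (((a == l) ∨ (a == r)) ∧ ((b == l) ∨ (b == r)))
  across a b sa sb with a ≟ᶠ l | a ≟ᶠ r | b ≟ᶠ l | b ≟ᶠ r
  ... | _        | yes refl | _        | _        = contradiction (trans (sym sa) sr) λ ()
  ... | _        | no _     | yes refl | _        = contradiction (trans (sym sl) sb) λ ()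
  ... | no a≢l   | no _     | no _     | _        = between a b sa sb (inj₁ a≢l)
  ... | yes refl | no _     | no _     | no b≢r   = between a b sa sb (inj₂ b≢r)
  ... | yes refl | no _     | no _     | yes refl = lr

  structure : ∀ a b → adj G a b ≡
    (side a xor side b) ∧ not (((a == l) ∨ (a == r)) ∧ ((b == l) ∨ (b == r)))
  structure a b with side a in sa | side b in sb
  ... | true  | true  = within-left a b sa sb
  ... | true  | false = across a b sa sb
  ... | false | true  = trans (adj-sym G a b) (trans (across b a sb sa)
          (cong not (Bool.∧-comm ((b == l) ∨ (b == r)) _)))
  ... | false | false = within-right a b sa sb

module _ {n p q : ℕ} (n≡p+q : n ≡ p + q) (halves : Halves p q) (2≤p : 2 ≤ p) (1≤q : 1 ≤ q)
  (G : Graph n) (triangle-free : TriangleFree G) (connected : Connected (complement G)) where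

  private
    E : Fin n → Fin n → Bool
    E = adj G

    no-triangle : ∀ i j k → E i j ≡ true → E j k ≡ true → E i k ≡ false
    no-triangle i j k ij jk with E i k in ik
    ... | false = refl
    ... | true  = contradiction (≡⇒T ij , ≡⇒T jk , ≡⇒T ik) (triangle-free i j k)

    module Root (i : Fin n) (many : p * q ≤ suc (twoWalks G i)) where

      N : Fin n → Bool
      N = E i

      missing : Fin n → Fin n → Bool
      missing j k = N j ∧ not (N k) ∧ not (E j k)

      #missing : ℕ
      #missing = ℕΣ.sum (λ j → count (missing j))

      d e : ℕ
      d = count N
      e = count (not ∘ N)

      -- A neighbour of N lies outside N, so 2-walks from i and missing pairs
      -- together make up N × (V ∖ N).
      walks+missing : twoWalks G i + #missing ≡ d * e
      walks+missing = begin
        twoWalks G i + #missing                    ≡⟨ ℕΣ⁺.∑-distrib-+ (λ j → 𝟙 (N j) * degree G j) (count ∘ missing) ⟨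
        ℕΣ.sum (λ j → 𝟙 (N j) * degree G j + count (missing j))  ≡⟨ ℕΣ.sum-cong-≗ row ⟩
        ℕΣ.sum (λ j → 𝟙 (N j) * e)                 ≡⟨ ℕΣ.*-distribʳ-sum e (𝟙 ∘ N) ⟨
        d * e                                      ∎
        where
        open ≡-Reasoning
        cell : ∀ j k → N j ≡ true → 𝟙 (E j k) + 𝟙 (not (N k) ∧ not (E j k)) ≡ 𝟙 (not (N k))
        cell j k ij with E j k in jk | N k in ik
        ... | true  | true  = contradiction (trans (sym ik) (no-triangle i j k ij jk)) λ ()
        ... | true  | false = refl
        ... | false | true  = refl
        ... | false | false = refl
        row : ∀ j → 𝟙 (N j) * degree G j + count (missing j) ≡ 𝟙 (N j) * e
        row j with N j in ij
        ... | false = sum-zero {n} (λ _ → refl)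
        ... | true  = begin
          degree G j + 0 + count (λ k → not (N k) ∧ not (E j k))  ≡⟨ cong (_+ count (λ k → not (N k) ∧ not (E j k))) (ℕ.+-identityʳ (degree G j)) ⟩
          degree G j + count (λ k → not (N k) ∧ not (E j k))      ≡⟨ ℕΣ⁺.∑-distrib-+ (𝟙 ∘ E j) (λ k → 𝟙 (not (N k) ∧ not (E j k))) ⟨
          ℕΣ.sum (λ k → 𝟙 (E j k) + 𝟙 (not (N k) ∧ not (E j k)))  ≡⟨ ℕΣ.sum-cong-≗ (λ k → cell j k ij) ⟩
          e                                                       ≡⟨ ℕ.+-identityʳ e ⟨
          e + 0                                                   ∎

      d+e : d + e ≡ p + q
      d+e = trans (count-complement N) n≡p+q

      de≤pq : d * e ≤ p * q
      de≤pq = proj₁ (balanced-product {a = d} {e} halves d+e)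

      few-missing : #missing ≤ 1
      few-missing = ℕ.+-cancelˡ-≤ (twoWalks G i) #missing 1 (begin
        twoWalks G i + #missing   ≡⟨ walks+missing ⟩
        d * e                     ≤⟨ de≤pq ⟩
        p * q                     ≤⟨ many ⟩
        suc (twoWalks G i)        ≡⟨ ℕ.+-comm 1 (twoWalks G i) ⟩
        twoWalks G i + 1          ∎)
        where open ℕ.≤-Reasoning

      -- An isolated `i` starts no walk of length 2, whereas `many` and p q ≥ 2 demand one. The
      -- neighbour obtained from this is where the walk in the complement begins.
      d≢0 : d ≢ 0
      d≢0 d≡0 = contradiction (begin
        2                     ≤⟨ ℕ.*-mono-≤ 2≤p 1≤q ⟩
        p * q                 ≤⟨ many ⟩
        suc (twoWalks G i)    ≤⟨ s≤s (ℕ.m≤m+n _ #missing) ⟩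
        suc (twoWalks G i + #missing) ≡⟨ cong suc (trans walks+missing (cong (_* e) d≡0)) ⟩
        1                     ∎) λ { (s≤s ()) }
        where open ℕ.≤-Reasoning

      missing⁻¹ : ∀ j k → 𝟙 (missing j k) ≡ 1 → (N j ≡ true × N k ≡ false) × E j k ≡ false
      missing⁻¹ j k m with N j | N k | E j k
      ... | true | false | false = (refl , refl) , refl

      not-missing : ∀ {j k} → N j ≡ true → N k ≡ false → 𝟙 (missing j k) ≡ 0 → E j k ≡ true
      not-missing {j} {k} ij ik m with N j | N k | E j k
      ... | true  | false | true  = refl
      not-missing {j} {k} refl refl () | true | false | false
      not-missing {j} {k} () ik m | false | _ | _
      not-missing {j} {k} ij () m | true | true | _

      -- Without a missing pair no edge of the complement leaves N.
      some-missing : #missing ≢ 0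
      some-missing none = contradiction (trans (sym (stays (connected j i) ij)) (adj-irrefl G i)) λ ()
        where
        neighbour : ∃[ j ] N j ≡ true
        neighbour = count-pos⁻¹ N (ℕ.n≢0⇒n>0 d≢0)
        j = proj₁ neighbour
        ij = proj₂ neighbour

        stays : ∀ {x y} → Star (Adj (complement G)) x y → N x ≡ true → N y ≡ true
        stays Star.ε ix = ix
        stays {x} (_◅_ {j = z} x~z walk) ix = stays walk step
          where
          step : N z ≡ true
          step with N z in iz
          ... | true  = refl
          ... | false rewrite not-missing {x} {z} ix iz
                (sum-zero⁻¹ (𝟙 ∘ missing x) (sum-zero⁻¹ (count ∘ missing) none x) z)
                | Bool.∧-zeroʳ (not (x == z)) = contradiction x~z λ ()

      one-missing : #missing ≡ 1
      one-missing = ℕ.≤-antisym few-missing (ℕ.n≢0⇒n>0 some-missing)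

      -- `many` concedes one unit and the single missing pair supplies it: with s for
      -- `twoWalks G i`, p q ≤ s + 1 = s + `#missing` = d e ≤ p q.
      de≡pq : d * e ≡ p * q
      de≡pq = ℕ.≤-antisym de≤pq (ℕ.≤-trans many
        (ℕ.≤-reflexive (trans (ℕ.+-comm 1 _) (trans (cong (twoWalks G i +_) (sym one-missing)) walks+missing))))

      row-l : ∃[ l ] count (missing l) ≡ 1 × (∀ j → j ≢ l → count (missing j) ≡ 0)
      row-l = sum-one⁻¹ (count ∘ missing) one-missing

      l : Fin n
      l = proj₁ row-l

      column-r : ∃[ r ] 𝟙 (missing l r) ≡ 1 × (∀ k → k ≢ r → 𝟙 (missing l k) ≡ 0)
      column-r = sum-one⁻¹ (𝟙 ∘ missing l) (proj₁ (proj₂ row-l))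

      r : Fin n
      r = proj₁ column-r

      missing-lr : (N l ≡ true × N r ≡ false) × E l r ≡ false
      missing-lr = missing⁻¹ l r (proj₁ (proj₂ column-r))

      full-row : ∀ {j k} → N j ≡ true → N k ≡ false → j ≢ l → E j k ≡ true
      full-row {j} {k} ij ik j≢l = not-missing ij ik
        (sum-zero⁻¹ (𝟙 ∘ missing j) (proj₂ (proj₂ row-l) j j≢l) k)

      full-column : ∀ {k} → N k ≡ false → k ≢ r → E l k ≡ true
      full-column {k} ik k≢r = not-missing (proj₁ (proj₁ missing-lr)) ik (proj₂ (proj₂ column-r) k k≢r)

      -- A vertex of N other than l would form a triangle with an edge ab outside N.
      -- Hence N = {l}, so n − 1 = pq and n = 3; but i, a, b and l are four vertices.
      outside-independent : ∀ a b → N a ≡ false → N b ≡ false → E a b ≡ false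
      outside-independent a b ia ib with E a b in ab
      ... | false = refl
      ... | true  = contradiction (arithmetic halves 2≤p 1≤q pq+1≡p+q) (ℕ.<⇒≱
            (subst (3 ≤_) e≡pq 3≤e))
        where
        only-l : ∀ j → j ≢ l → 𝟙 (N j) ≡ 0
        only-l j j≢l with N j in ij
        ... | false = refl
        ... | true  = contradiction (trans (sym (no-triangle j a b (full-row ij ia j≢l) ab)) (full-row ij ib j≢l)) λ ()

        d≡1 : d ≡ 1
        d≡1 = trans (sum-single (𝟙 ∘ N) l only-l) (cong 𝟙 (proj₁ (proj₁ missing-lr)))

        e≡pq : e ≡ p * q
        e≡pq = trans (sym (ℕ.*-identityˡ e)) (trans (cong (_* e) (sym d≡1)) de≡pq)

        pq+1≡p+q : suc (p * q) ≡ p + q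
        pq+1≡p+q = trans (cong suc (sym e≡pq)) (trans (cong (_+ e) (sym d≡1)) d+e)

        a≢b : a ≢ b
        a≢b refl = contradiction (trans (sym ab) (adj-irrefl G a)) λ ()
        i≢a : i ≢ a
        i≢a refl = contradiction (trans (sym ab) ib) λ ()
        i≢b : i ≢ b
        i≢b refl = contradiction (trans (sym ab) (trans (adj-sym G a i) ia)) λ ()

        3≤e : 3 ≤ e
        3≤e = count-three (not ∘ N) i≢a i≢b a≢b (cong not (adj-irrefl G i)) (cong not ia) (cong not ib)

        -- The equation says (p - 1)(q - 1) = 0. As p ≥ 2, this gives q = 1, and then balance leaves
        -- only p = 2.
        arithmetic : ∀ {p q} → Halves p q → 2 ≤ p → 1 ≤ q → suc (p * q) ≡ p + q → p * q ≤ 2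
        arithmetic {suc (suc p)} {suc zero} (inj₂ refl) _ _ _ = ℕ.≤-refl
        arithmetic {suc (suc p)} {suc (suc q)} _ _ _ eq = contradiction eq (ℕ.>⇒≢
          (ℕ.m+n≤o⇒m≤o _ (ℕ.≤-reflexive (solve 2 (λ p q →
            con 1 :+ ((con 2 :+ p) :+ (con 2 :+ q)) :+ (p :+ q :+ p :* q)
              := con 1 :+ (con 2 :+ p) :* (con 2 :+ q)) refl p q))))
          where open Data.Nat.Solver.+-*-Solver
        arithmetic {suc zero} _ (s≤s ()) _ _

      fill : ∀ a b → N a ≡ true → N b ≡ false → b ≢ r → E a b ≡ true
      fill a b ia ib b≢r with a ≟ᶠ l
      ... | yes a≡l = trans (cong (λ x → E x b) a≡l) (full-column ib b≢r)
      ... | no a≢l  = full-row ia ib a≢l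

      extremal : BipartiteMinusEdge G d e
      extremal = only-edge-missing G N l r
        (proj₁ (proj₁ missing-lr)) (proj₂ (proj₁ missing-lr)) (proj₂ missing-lr)
        (λ a b ia ib → no-triangle a i b (trans (adj-sym G a i) ia) ib)
        outside-independent
        (λ { a b ia ib (inj₁ a≢l) → full-row ia ib a≢l
           ; a b ia ib (inj₂ b≢r) → fill a b ia ib b≢r })

  -- p q ≤ 1 + s_i says that at most one pair is missing from N(i) × (V ∖ N(i)).
  many-twoWalks⇒extremal : ∀ i → p * q ≤ suc (twoWalks G i) → BipartiteMinusEdge G p q
  many-twoWalks⇒extremal i many
    with proj₂ (balanced-product {a = Root.d i many} {Root.e i many} halves (Root.d+e i many)) (Root.de≡pq i many)
  ... | inj₁ (d≡p , e≡q) = subst₂ (BipartiteMinusEdge G) d≡p e≡q (Root.extremal i many)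
  ... | inj₂ (d≡q , e≡p) = swap-sides (subst₂ (BipartiteMinusEdge G) d≡q e≡p (Root.extremal i many))

  -- The decidable split on which the theorem rests: a vertex failing 2 + s ≤ p q satisfies p q ≤ 1
  -- + s, and one such vertex fixes the whole graph.
  extremal-or-few-twoWalks : BipartiteMinusEdge G p q ⊎ (∀ i → 2 + twoWalks G i ≤ p * q)
  extremal-or-few-twoWalks with all? (λ i → 2 + twoWalks G i ℕ.≤? p * q)
  ... | yes few = inj₂ few
  ... | no ¬few with ¬∀⟶∃¬ n _ (λ i → 2 + twoWalks G i ℕ.≤? p * q) ¬few
  ...   | i , ¬few-i = inj₁ (many-twoWalks⇒extremal i (ℕ.≤-pred (ℕ.≰⇒> ¬few-i)))

-- Rational inequalities

-- Reduces an inequality to a ring identity: the nonnegative difference `c` is named explicitly, and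
-- the solver can check the rest.
≤-gap : ∀ {a b} c → 0ℚ ℚ.≤ c → b ≡ a ℚ.+ c → a ℚ.≤ b
≤-gap {a} c 0≤c refl = subst (ℚ._≤ a ℚ.+ c) (ℚ.+-identityʳ a) (ℚ.+-monoʳ-≤ a 0≤c)

0≤+ : ∀ {a b} → 0ℚ ℚ.≤ a → 0ℚ ℚ.≤ b → 0ℚ ℚ.≤ a ℚ.+ b
0≤+ = ℚ.+-mono-≤

0≤* : ∀ {a b} → 0ℚ ℚ.≤ a → 0ℚ ℚ.≤ b → 0ℚ ℚ.≤ a ℚ.* b
0≤* {a} {b} 0≤a 0≤b = ℚ.nonNegative⁻¹ _ {{ℚ.nonNeg*nonNeg⇒nonNeg a {{ℚ.nonNegative 0≤a}} b {{ℚ.nonNegative 0≤b}}}}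

0≤- : ∀ {a b} → a ℚ.≤ b → 0ℚ ℚ.≤ b ℚ.- a
0≤- {a} {b} a≤b = subst (ℚ._≤ b ℚ.- a) (ℚ.+-inverseʳ a) (ℚ.+-monoˡ-≤ (ℚ.- a) a≤b)

*-mono-≤ : ∀ {a b c d} → 0ℚ ℚ.≤ a → 0ℚ ℚ.≤ c → a ℚ.≤ b → c ℚ.≤ d → a ℚ.* c ℚ.≤ b ℚ.* d
*-mono-≤ {a} {b} {c} {d} 0≤a 0≤c a≤b c≤d = ℚ.≤-trans
  (ℚ.*-monoʳ-≤-nonNeg c {{ℚ.nonNegative 0≤c}} a≤b)
  (ℚ.*-monoˡ-≤-nonNeg b {{ℚ.nonNegative (ℚ.≤-trans 0≤a a≤b)}} c≤d)

0≤square : ∀ a → 0ℚ ℚ.≤ a ℚ.* a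
0≤square a with ℚ.≤-total 0ℚ a
... | inj₁ 0≤a = 0≤* 0≤a 0≤a
... | inj₂ a≤0 = subst (0ℚ ℚ.≤_) (solve 1 (λ a → (:- a) :* (:- a) := a :* a) refl a)
                   (0≤* (ℚ.neg-antimono-≤ a≤0) (ℚ.neg-antimono-≤ a≤0))
  where open +-*-Solver

0≤1 : 0ℚ ℚ.≤ 1ℚ
0≤1 = ℚ.nonNegative⁻¹ 1ℚ

½+½ : ∀ p → ½ ℚ.* p ℚ.+ ½ ℚ.* p ≡ p
½+½ p = trans (sym (ℚ.*-distribʳ-+ p ½ ½)) (ℚ.*-identityˡ p)

½* : ∀ p → ½ ℚ.* (p ℚ.+ p) ≡ p
½* p = trans (ℚ.*-distribˡ-+ ½ p p) (½+½ p)

½≤ : ∀ {p} → 0ℚ ℚ.≤ p → ½ ℚ.* p ℚ.≤ p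
½≤ {p} 0≤p = ≤-gap (½ ℚ.* p) (0≤* (ℚ.nonNegative⁻¹ ½) 0≤p) (sym (½+½ p))

∣-∣≤ : ∀ {a b w} → a ℚ.- b ℚ.≤ w → b ℚ.- a ℚ.≤ w → ∣ a ℚ.- b ∣ ℚ.≤ w
∣-∣≤ {a} {b} {w} ≤w ≤w′ with ℚ.∣p∣≡p∨∣p∣≡-p (a ℚ.- b)
... | inj₁ eq = subst (ℚ._≤ w) (sym eq) ≤w
... | inj₂ eq = subst (ℚ._≤ w) (sym (trans eq (solve 2 (λ a b → :- (a :- b) := b :- a) refl a b))) ≤w′
  where open +-*-Solver

-- Natural numbers and Booleans as rationals

cast : ℕ → ℚ
cast zero    = 0ℚ
cast (suc m) = 1ℚ ℚ.+ cast m

cast-+ : ∀ m n → cast (m + n) ≡ cast m ℚ.+ cast n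
cast-+ zero    n = sym (ℚ.+-identityˡ (cast n))
cast-+ (suc m) n = trans (cong (1ℚ ℚ.+_) (cast-+ m n)) (sym (ℚ.+-assoc 1ℚ (cast m) (cast n)))

cast-* : ∀ m n → cast (m * n) ≡ cast m ℚ.* cast n
cast-* zero    n = sym (ℚ.*-zeroˡ (cast n))
cast-* (suc m) n = begin
  cast (n + m * n)                          ≡⟨ cast-+ n (m * n) ⟩
  cast n ℚ.+ cast (m * n)                   ≡⟨ cong (cast n ℚ.+_) (cast-* m n) ⟩
  cast n ℚ.+ cast m ℚ.* cast n              ≡⟨ solve 2 (λ m n → n :+ m :* n := (con 1ℚ :+ m) :* n) refl (cast m) (cast n) ⟩
  (1ℚ ℚ.+ cast m) ℚ.* cast n                ∎
  where open ≡-Reasoning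
        open +-*-Solver

0≤cast : ∀ m → 0ℚ ℚ.≤ cast m
0≤cast zero    = ℚ.≤-refl
0≤cast (suc m) = 0≤+ 0≤1 (0≤cast m)

cast-mono : ∀ {m n} → m ≤ n → cast m ℚ.≤ cast n
cast-mono {n = n} z≤n = 0≤cast n
cast-mono (s≤s m≤n)   = ℚ.+-monoʳ-≤ 1ℚ (cast-mono m≤n)

cast-sum : (f : Fin n → ℕ) → cast (ℕΣ.sum f) ≡ ℚΣ.sum (cast ∘ f)
cast-sum {zero}  f = refl
cast-sum {suc n} f = trans (cast-+ (f zero) _) (cong (cast (f zero) ℚ.+_) (cast-sum (f ∘ suc)))

𝟙ℚ : Bool → ℚ
𝟙ℚ b = if b then 1ℚ else 0ℚ

cast-𝟙 : ∀ b → cast (𝟙 b) ≡ 𝟙ℚ b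
cast-𝟙 true  = refl
cast-𝟙 false = refl

0≤𝟙ℚ : ∀ b → 0ℚ ℚ.≤ 𝟙ℚ b
0≤𝟙ℚ true  = 0≤1
0≤𝟙ℚ false = ℚ.≤-refl

cast-count : (f : Fin n → Bool) → cast (count f) ≡ ℚΣ.sum (𝟙ℚ ∘ f)
cast-count f = trans (cast-sum (𝟙 ∘ f)) (ℚΣ.sum-cong-≗ (cast-𝟙 ∘ f))

sumℚ-mono : {f g : Fin n → ℚ} → (∀ i → f i ℚ.≤ g i) → ℚΣ.sum f ℚ.≤ ℚΣ.sum g
sumℚ-mono {zero}  f≤g = ℚ.≤-refl
sumℚ-mono {suc n} f≤g = ℚ.+-mono-≤ (f≤g zero) (sumℚ-mono (f≤g ∘ suc))

0≤sum : {f : Fin n → ℚ} → (∀ i → 0ℚ ℚ.≤ f i) → 0ℚ ℚ.≤ ℚΣ.sum f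
0≤sum {zero}  0≤f = ℚ.≤-refl
0≤sum {suc n} 0≤f = 0≤+ (0≤f zero) (0≤sum (0≤f ∘ suc))

term≤sum : {f : Fin n → ℚ} → (∀ i → 0ℚ ℚ.≤ f i) → ∀ i → f i ℚ.≤ ℚΣ.sum f
term≤sum {suc n} {f} 0≤f zero    = ≤-gap _ (0≤sum (0≤f ∘ suc)) refl
term≤sum {suc n} {f} 0≤f (suc i) = ℚ.≤-trans (term≤sum (0≤f ∘ suc) i)
  (≤-gap (f zero) (0≤f zero) (ℚ.+-comm (f zero) _))

-- Spectral bound

module _ (G : Graph n) where

  image : (Fin n → ℚ) → Fin n → ℚ
  image x i = ℚΣ.sum (λ j → 𝟙ℚ (adj G i j) ℚ.* x j)

private
  Σ-at Σ²-at : (Fin n → Bool) → (Fin n → ℚ) → ℚ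
  Σ-at  f x = ℚΣ.sum (λ j → 𝟙ℚ (f j) ℚ.* x j)
  Σ²-at f x = ℚΣ.sum (λ j → 𝟙ℚ (f j) ℚ.* (x j ℚ.* x j))

  -- Expansion of ∑ (x_j - t)² ≥ 0 over the indices selected by `f`.
  young : (f : Fin n → Bool) (x : Fin n → ℚ) (t : ℚ) →
    (t ℚ.+ t) ℚ.* Σ-at f x ℚ.≤ Σ²-at f x ℚ.+ ℚΣ.sum (𝟙ℚ ∘ f) ℚ.* (t ℚ.* t)
  young {zero}  f x t = ℚ.≤-reflexive (solve 1 (λ t → (t :+ t) :* con 0ℚ := con 0ℚ :+ con 0ℚ :* (t :* t)) refl t)
    where open +-*-Solver
  young {suc n} f x t = ≤-gap _
    (0≤+ (0≤* (0≤𝟙ℚ (f zero)) (0≤square (x zero ℚ.- t))) (0≤- (young (f ∘ suc) (x ∘ suc) t)))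
    (solve 6 (λ w x t s q d →
      w :* (x :* x) :+ q :+ (w :+ d) :* (t :* t) :=
      (t :+ t) :* (w :* x :+ s) :+ (w :* ((x :- t) :* (x :- t)) :+ (q :+ d :* (t :* t) :- (t :+ t) :* s)))
      refl (𝟙ℚ (f zero)) (x zero) t (Σ-at (f ∘ suc) (x ∘ suc)) (Σ²-at (f ∘ suc) (x ∘ suc)) (ℚΣ.sum (𝟙ℚ ∘ f ∘ suc)))
    where open +-*-Solver

  -- Induction on the length. With s, q, d for the sum, the sum of squares and the count of the
  -- tail, a new selected entry x raises the right side minus the left side by q + d x² - 2 x s,
  -- which is nonnegative by `young` at t = x.
  cauchy-schwarz : (f : Fin n → Bool) (x : Fin n → ℚ) →
    Σ-at f x ℚ.* Σ-at f x ℚ.≤ ℚΣ.sum (𝟙ℚ ∘ f) ℚ.* Σ²-at f x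
  cauchy-schwarz {zero}  f x = ℚ.≤-refl
  cauchy-schwarz {suc n} f x with f zero
  ... | false = subst₂ ℚ._≤_
      (solve 2 (λ x s → s :* s := (con 0ℚ :* x :+ s) :* (con 0ℚ :* x :+ s)) refl (x zero) s)
      (solve 3 (λ x q d → d :* q := (con 0ℚ :+ d) :* (con 0ℚ :* (x :* x) :+ q)) refl (x zero) q d)
      (cauchy-schwarz (f ∘ suc) (x ∘ suc))
    where open +-*-Solver
          s = Σ-at (f ∘ suc) (x ∘ suc)
          q = Σ²-at (f ∘ suc) (x ∘ suc)
          d = ℚΣ.sum (𝟙ℚ ∘ f ∘ suc)
  ... | true  = ≤-gap _
      (0≤+ (0≤- (young (f ∘ suc) (x ∘ suc) (x zero))) (0≤- (cauchy-schwarz (f ∘ suc) (x ∘ suc))))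
      (solve 4 (λ x s q d →
        (con 1ℚ :+ d) :* (con 1ℚ :* (x :* x) :+ q) :=
        (con 1ℚ :* x :+ s) :* (con 1ℚ :* x :+ s)
          :+ ((q :+ d :* (x :* x) :- (x :+ x) :* s) :+ (d :* q :- s :* s)))
        refl (x zero) (Σ-at (f ∘ suc) (x ∘ suc)) (Σ²-at (f ∘ suc) (x ∘ suc)) (ℚΣ.sum (𝟙ℚ ∘ f ∘ suc)))
    where open +-*-Solver

squareNorm : (Fin n → ℚ) → ℚ
squareNorm x = ℚΣ.sum (λ i → x i ℚ.* x i)

-- Cauchy-Schwarz over the neighbours of i costs the factor `degree G i`. After the sums are
-- exchanged, symmetry of `adj` gathers the degrees of the neighbours of j in front of x_j², and
-- these add up to `twoWalks G j`.
image-norm : (G : Graph n) (M : ℕ) → (∀ i → twoWalks G i ≤ M) → (x : Fin n → ℚ) →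
  squareNorm (image G x) ℚ.≤ cast M ℚ.* squareNorm x
image-norm {n} G M walks≤M x = begin
  ℚΣ.sum (λ i → image G x i ℚ.* image G x i)
    ≤⟨ sumℚ-mono (λ i → cauchy-schwarz (adj G i) x) ⟩
  ℚΣ.sum (λ i → d i ℚ.* ℚΣ.sum (λ j → w i j ℚ.* (x j ℚ.* x j)))
    ≡⟨ ℚΣ.sum-cong-≗ (λ i → ℚΣ.*-distribˡ-sum (d i) (λ j → w i j ℚ.* (x j ℚ.* x j))) ⟩
  ℚΣ.sum (λ i → ℚΣ.sum (λ j → d i ℚ.* (w i j ℚ.* (x j ℚ.* x j))))
    ≡⟨ ℚΣ⁺.∑-comm (λ i j → d i ℚ.* (w i j ℚ.* (x j ℚ.* x j))) ⟩
  ℚΣ.sum (λ j → ℚΣ.sum (λ i → d i ℚ.* (w i j ℚ.* (x j ℚ.* x j))))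
    ≡⟨ ℚΣ.sum-cong-≗ (λ j → trans
         (ℚΣ.sum-cong-≗ (λ i → trans (reorder (d i) (w i j) (x j ℚ.* x j))
           (cong (λ b → 𝟙ℚ b ℚ.* d i ℚ.* (x j ℚ.* x j)) (adj-sym G i j))))
         (sym (ℚΣ.*-distribʳ-sum (x j ℚ.* x j) (λ i → w j i ℚ.* d i)))) ⟩
  ℚΣ.sum (λ j → ℚΣ.sum (λ i → w j i ℚ.* d i) ℚ.* (x j ℚ.* x j))
    ≤⟨ sumℚ-mono (λ j → ℚ.*-monoʳ-≤-nonNeg (x j ℚ.* x j) {{ℚ.nonNegative (0≤square (x j))}} (walks j)) ⟩
  ℚΣ.sum (λ j → cast M ℚ.* (x j ℚ.* x j))
    ≡⟨ ℚΣ.*-distribˡ-sum (cast M) (λ j → x j ℚ.* x j) ⟨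
  cast M ℚ.* squareNorm x ∎
  where
  open ℚ.≤-Reasoning
  w : Fin n → Fin n → ℚ
  w i j = 𝟙ℚ (adj G i j)
  d : Fin n → ℚ
  d i = ℚΣ.sum (w i)
  reorder : ∀ d w s → d ℚ.* (w ℚ.* s) ≡ w ℚ.* d ℚ.* s
  reorder = solve 3 (λ d w s → d :* (w :* s) := w :* d :* s) refl
    where open +-*-Solver
  walks : ∀ j → ℚΣ.sum (λ i → w j i ℚ.* d i) ℚ.≤ cast M
  walks j = subst (ℚ._≤ cast M)
    (trans (cast-sum (λ i → 𝟙 (adj G j i) * degree G i))
      (ℚΣ.sum-cong-≗ (λ i → trans (cast-* (𝟙 (adj G j i)) (degree G i))
        (cong₂ ℚ._*_ (cast-𝟙 (adj G j i)) (cast-count (adj G i))))))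
    (cast-mono (walks≤M j))

-- Null sequences

Null : (ℕ → ℚ) → Set
Null z = ∀ ε → .{{Positive ε}} → ∃[ N ] (∀ k → N ≤ k → ∣ z k ∣ ℚ.< ε)

Eventually : (ℕ → Set) → Set
Eventually P = ∃[ N ] (∀ k → N ≤ k → P k)

both : {P Q : ℕ → Set} → Eventually P → Eventually Q → Eventually (λ k → P k × Q k)
both (M , p) (N , q) = M ⊔ N , λ k le → p k (ℕ.m⊔n≤o⇒m≤o M N le) , q k (ℕ.m⊔n≤o⇒n≤o M N le)

weaken : {P Q : ℕ → Set} → (∀ k → P k → Q k) → Eventually P → Eventually Q
weaken f (N , p) = N , λ k le → f k (p k le)

null-dominated : ∀ {w z} → Eventually (λ k → ∣ w k ∣ ℚ.≤ ∣ z k ∣) → Null z → Null w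
null-dominated dom nz ε = weaken (λ k (≤z , z<ε) → ℚ.≤-<-trans ≤z z<ε) (both dom (nz ε))

null-cong : ∀ {w z} → (∀ k → w k ≡ z k) → Null z → Null w
null-cong eq = null-dominated (0 , λ k _ → ℚ.≤-reflexive (cong ∣_∣ (eq k)))

null-between : ∀ {w z} → Eventually (λ k → 0ℚ ℚ.≤ w k × w k ℚ.≤ z k) → Null z → Null w
null-between {w} {z} sandwich = null-dominated (weaken step sandwich)
  where
  step : ∀ k → 0ℚ ℚ.≤ w k × w k ℚ.≤ z k → ∣ w k ∣ ℚ.≤ ∣ z k ∣
  step k (0≤w , w≤z) = subst₂ ℚ._≤_ (sym (ℚ.0≤p⇒∣p∣≡p 0≤w)) (sym (ℚ.0≤p⇒∣p∣≡p (ℚ.≤-trans 0≤w w≤z))) w≤z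

null-0 : Null (λ _ → 0ℚ)
null-0 ε = 0 , λ _ _ → ℚ.positive⁻¹ ε

null-+ : ∀ {w z} → Null w → Null z → Null (λ k → w k ℚ.+ z k)
null-+ {w} {z} nw nz ε = weaken step (both (nw (½ ℚ.* ε) {{half-pos ε}}) (nz (½ ℚ.* ε) {{half-pos ε}}))
  where
  step : ∀ k → _ → ∣ w k ℚ.+ z k ∣ ℚ.< ε
  step k (w< , z<) = ℚ.≤-<-trans (ℚ.∣p+q∣≤∣p∣+∣q∣ (w k) (z k))
    (subst (∣ w k ∣ ℚ.+ ∣ z k ∣ ℚ.<_) (halves ε) (ℚ.+-mono-< w< z<))

null-* : ∀ {a z} → EventuallyBounded a → Null z → Null (λ k → a k ℚ.* z k)
null-* {a} {z} (B , posB , bounded) nz ε with divide ε B {{it}} {{posB}}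
... | δ , posδ , Bδ≡ε = weaken (λ k (a≤B , z<δ) →
        subst (∣ a k ℚ.* z k ∣ ℚ.<_) Bδ≡ε (product< B δ (a k) (z k) {{posB}} a≤B z<δ))
      (both bounded (nz δ {{posδ}}))

null-scale : ∀ a {z} → Null z → Null (λ k → a ℚ.* z k)
null-scale a {z} = null-* {a = λ _ → a} {z} (eventually-bounded {λ _ → a} (constant-cauchy a))

null-neg : ∀ {z} → Null z → Null (λ k → ℚ.- z k)
null-neg {z} = null-dominated (0 , λ k _ → ℚ.≤-reflexive (ℚ.∣-p∣≡∣p∣ (z k)))

null-sum : {z : Fin n → ℕ → ℚ} → (∀ i → Null (z i)) → Null (λ k → ℚΣ.sum (λ i → z i k))
null-sum {zero}  nz = null-0
null-sum {suc n} nz = null-+ (nz zero) (null-sum (nz ∘ suc))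

null-sqrt : ∀ {w} → Null (λ k → w k ℚ.* w k) → Null w
null-sqrt {w} nw² ε = weaken step (nw² (ε ℚ.* ε) {{ℚ.pos*pos⇒pos ε ε}})
  where
  step : ∀ k → ∣ w k ℚ.* w k ∣ ℚ.< ε ℚ.* ε → ∣ w k ∣ ℚ.< ε
  step k w²<ε² = ℚ.≰⇒> λ ε≤w → ℚ.<-irrefl refl (ℚ.<-≤-trans w²<ε²
    (ℚ.≤-trans (*-mono-≤ 0≤ε 0≤ε ε≤w ε≤w) (ℚ.≤-reflexive (sym (ℚ.∣p*q∣≡∣p∣*∣q∣ (w k) (w k))))))
    where 0≤ε = ℚ.<⇒≤ (ℚ.positive⁻¹ ε)

null-cancel : ∀ η → .{{Positive η}} → ∀ {z} → Null (λ k → η ℚ.* z k) → Null z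
null-cancel η {z} nηz = null-cong
  (λ k → sym (trans (sym (ℚ.*-assoc 1/η η (z k))) (trans (cong (ℚ._* z k) (ℚ.*-inverseˡ η)) (ℚ.*-identityˡ (z k)))))
  (null-scale 1/η nηz)
  where
  instance _ = ℚ.pos⇒nonZero η
  1/η = ℚ.1/ η

-- Order of real numbers

∣p∣<ε⇒p<ε : ∀ {p ε} → ∣ p ∣ ℚ.< ε → p ℚ.< ε
∣p∣<ε⇒p<ε {p} = ℚ.≤-<-trans (p≤∣p∣ p)
  where
  p≤∣p∣ : ∀ p → p ℚ.≤ ∣ p ∣
  p≤∣p∣ p with ℚ.≤-total 0ℚ p
  ... | inj₁ 0≤p = ℚ.≤-reflexive (sym (ℚ.0≤p⇒∣p∣≡p 0≤p))
  ... | inj₂ p≤0 = ℚ.≤-trans p≤0 (ℚ.0≤∣p∣ p)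

distance-< : ∀ {a b ε} → ∣ a ℚ.- b ∣ ℚ.< ε → a ℚ.< b ℚ.+ ε
distance-< {a} {b} {ε} close = subst₂ ℚ._<_
  (solve 2 (λ a b → b :+ (a :- b) := a) refl a b) refl
  (ℚ.+-monoʳ-< b (∣p∣<ε⇒p<ε close))
  where open +-*-Solver

-- A tail with x > y + 3η would give y <ℝ x.
≤ℝ⇒eventually : ∀ x y → x ≤ℝ y → ∀ ε → .{{Positive ε}} → Eventually (λ k → seq x k ℚ.≤ seq y k ℚ.+ ε)
≤ℝ⇒eventually x y x≤y ε = decide (seq x N ℚ.≤? seq y N ℚ.+ (η ℚ.+ η ℚ.+ η))
  where
  open +-*-Solver
  η : ℚ
  η = ½ ℚ.* (½ ℚ.* (½ ℚ.* ε))
  instance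
    pos-η : Positive η
    pos-η = half-pos (½ ℚ.* (½ ℚ.* ε)) {{half-pos (½ ℚ.* ε) {{half-pos ε}}}}
  0≤η : 0ℚ ℚ.≤ η
  0≤η = ℚ.<⇒≤ (ℚ.positive⁻¹ η)
  Nx = proj₁ (cauchy x η)
  Ny = proj₁ (cauchy y η)
  N  = Nx ⊔ Ny
  closeˣ : ∀ k l → N ≤ k → N ≤ l → seq x k ℚ.< seq x l ℚ.+ η
  closeˣ k l N≤k N≤l = distance-< (proj₂ (cauchy x η) k l (ℕ.m⊔n≤o⇒m≤o Nx Ny N≤k) (ℕ.m⊔n≤o⇒m≤o Nx Ny N≤l))
  closeʸ : ∀ k l → N ≤ k → N ≤ l → seq y k ℚ.< seq y l ℚ.+ η
  closeʸ k l N≤k N≤l = distance-< (proj₂ (cauchy y η) k l (ℕ.m⊔n≤o⇒n≤o Nx Ny N≤k) (ℕ.m⊔n≤o⇒n≤o Nx Ny N≤l))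

  decide : Dec (seq x N ℚ.≤ seq y N ℚ.+ (η ℚ.+ η ℚ.+ η)) → Eventually (λ k → seq x k ℚ.≤ seq y k ℚ.+ ε)
  decide (yes xN≤) = N , λ k N≤k → begin
    seq x k                                         ≤⟨ ℚ.<⇒≤ (closeˣ k N N≤k ℕ.≤-refl) ⟩
    seq x N ℚ.+ η                                   ≤⟨ ℚ.+-monoˡ-≤ η xN≤ ⟩
    seq y N ℚ.+ (η ℚ.+ η ℚ.+ η) ℚ.+ η               ≤⟨ ℚ.+-monoˡ-≤ η (ℚ.+-monoˡ-≤ (η ℚ.+ η ℚ.+ η) (ℚ.<⇒≤ (closeʸ N k ℕ.≤-refl N≤k))) ⟩
    seq y k ℚ.+ η ℚ.+ (η ℚ.+ η ℚ.+ η) ℚ.+ η         ≤⟨ ≤-gap (η ℚ.+ η ℚ.+ η) (0≤+ (0≤+ 0≤η 0≤η) 0≤η)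
      (trans (cong (seq y k ℚ.+_) eighths)
        (solve 2 (λ y h → y :+ (h :+ h :+ (h :+ h) :+ (h :+ h :+ (h :+ h)))
          := y :+ h :+ (h :+ h :+ h) :+ h :+ (h :+ h :+ h)) refl (seq y k) η)) ⟩
    seq y k ℚ.+ ε                                   ∎
    where
    open ℚ.≤-Reasoning
    quarters : ½ ℚ.* (½ ℚ.* ε) ≡ η ℚ.+ η
    quarters = sym (halves (½ ℚ.* (½ ℚ.* ε)))
    eighths : ε ≡ η ℚ.+ η ℚ.+ (η ℚ.+ η) ℚ.+ (η ℚ.+ η ℚ.+ (η ℚ.+ η))
    eighths = trans (sym (halves ε)) (cong₂ ℚ._+_ half half)
      where
      half : ½ ℚ.* ε ≡ η ℚ.+ η ℚ.+ (η ℚ.+ η)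
      half = trans (sym (halves (½ ℚ.* ε))) (cong₂ ℚ._+_ quarters quarters)
  decide (no xN≰) = contradiction (η , pos-η , N , below) x≤y
    where
    open ℚ.≤-Reasoning
    below : ∀ k → N ≤ k → seq y k ℚ.+ η ℚ.≤ seq x k
    below k N≤k = begin
      seq y k ℚ.+ η                             ≤⟨ ℚ.+-monoˡ-≤ η (ℚ.<⇒≤ (closeʸ k N N≤k ℕ.≤-refl)) ⟩
      seq y N ℚ.+ η ℚ.+ η                       ≡⟨ solve 2 (λ y h → y :+ h :+ h := y :+ (h :+ h :+ h) :- h) refl (seq y N) η ⟩
      seq y N ℚ.+ (η ℚ.+ η ℚ.+ η) ℚ.- η         ≤⟨ ℚ.+-monoˡ-≤ (ℚ.- η) (ℚ.<⇒≤ (ℚ.≰⇒> xN≰)) ⟩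
      seq x N ℚ.- η                             ≤⟨ ℚ.+-monoˡ-≤ (ℚ.- η) (ℚ.<⇒≤ (closeˣ N k ℕ.≤-refl N≤k)) ⟩
      seq x k ℚ.+ η ℚ.- η                       ≡⟨ solve 2 (λ x h → x :+ h :- h := x) refl (seq x k) η ⟩
      seq x k                                   ∎

-- The weak inequality costs an arbitrarily small rational, here half of the gap; the other half
-- survives.
<-≤-trans : ∀ x y z → x <ℝ y → y ≤ℝ z → x <ℝ z
<-≤-trans x y z (ε , posε , N , x+ε≤y) y≤z = ½ε , half-pos ε {{posε}} ,
  weaken step (both (N , x+ε≤y) (≤ℝ⇒eventually y z y≤z ½ε {{half-pos ε {{posε}}}}))
  where
  ½ε = ½ ℚ.* ε
  step : ∀ k → seq x k ℚ.+ ε ℚ.≤ seq y k × seq y k ℚ.≤ seq z k ℚ.+ ½ε → seq x k ℚ.+ ½ε ℚ.≤ seq z k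
  step k (x≤ , y≤) = begin
    seq x k ℚ.+ ½ε            ≡⟨ solve 2 (λ x h → x :+ h := x :+ (h :+ h) :- h) refl (seq x k) ½ε ⟩
    seq x k ℚ.+ (½ε ℚ.+ ½ε) ℚ.- ½ε  ≡⟨ cong (λ e → seq x k ℚ.+ e ℚ.- ½ε) (halves ε) ⟩
    seq x k ℚ.+ ε ℚ.- ½ε      ≤⟨ ℚ.+-monoˡ-≤ (ℚ.- ½ε) (ℚ.≤-trans x≤ y≤) ⟩
    seq z k ℚ.+ ½ε ℚ.- ½ε     ≡⟨ solve 2 (λ z h → z :+ h :- h := z) refl (seq z k) ½ε ⟩
    seq z k                   ∎
    where open ℚ.≤-Reasoning
          open +-*-Solver

<-irreflexive : ∀ x → ¬ (x <ℝ x)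
<-irreflexive x (ε , posε , N , x+ε≤x) = ℚ.<-irrefl refl (ℚ.<-≤-trans
  (subst (ℚ._< seq x N ℚ.+ ε) (ℚ.+-identityʳ (seq x N)) (ℚ.+-monoʳ-< (seq x N) (ℚ.positive⁻¹ ε {{posε}})))
  (x+ε≤x N ℕ.≤-refl))

<⇒≤ : ∀ x y → x <ℝ y → x ≤ℝ y
<⇒≤ x y (δ , posδ , x+δ≤y) (ε , posε , y+ε≤x) = <-irreflexive x
  (δ , posδ , weaken (λ k (y+ε≤x , x+δ≤y) → ℚ.≤-trans x+δ≤y
    (ℚ.≤-trans (≤-gap ε (ℚ.<⇒≤ (ℚ.positive⁻¹ ε {{posε}})) refl) y+ε≤x)) (both y+ε≤x x+δ≤y))

≃-sym : ∀ x y → x ≃ y → y ≃ x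
≃-sym x y x≃y ε = weaken (λ k → subst (ℚ._< ε) (swap (seq x k) (seq y k))) (x≃y ε)
  where
  swap : ∀ a b → ∣ a ℚ.- b ∣ ≡ ∣ b ℚ.- a ∣
  swap a b = trans (sym (ℚ.∣-p∣≡∣p∣ (a ℚ.- b))) (cong ∣_∣ (solve 2 (λ a b → :- (a :- b) := b :- a) refl a b))
    where open +-*-Solver

≃⇒≤ : ∀ x y → x ≃ y → x ≤ℝ y
≃⇒≤ x y x≃y (ε , posε , y+ε≤x) with both y+ε≤x (x≃y ε {{posε}})
... | N , at = ℚ.<-irrefl refl (ℚ.≤-<-trans (proj₁ (at N ℕ.≤-refl)) (distance-< (proj₂ (at N ℕ.≤-refl))))

≤-antisym : ∀ x y → x ≤ℝ y → y ≤ℝ x → x ≃ y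
≤-antisym x y x≤y y≤x ε = weaken step
  (both (≤ℝ⇒eventually x y x≤y (½ ℚ.* ε) {{half-pos ε}}) (≤ℝ⇒eventually y x y≤x (½ ℚ.* ε) {{half-pos ε}}))
  where
  open +-*-Solver
  ½ε = ½ ℚ.* ε
  ½ε<ε : ½ε ℚ.< ε
  ½ε<ε = subst₂ ℚ._<_ (ℚ.+-identityʳ ½ε) (halves ε) (ℚ.+-monoʳ-< ½ε (ℚ.positive⁻¹ ½ε {{half-pos ε}}))
  move : ∀ {a b} → a ℚ.≤ b ℚ.+ ½ε → a ℚ.- b ℚ.≤ ½ε
  move {a} {b} a≤ = subst (a ℚ.- b ℚ.≤_) (solve 2 (λ b h → b :+ h :- b := h) refl b ½ε) (ℚ.+-monoˡ-≤ (ℚ.- b) a≤)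
  step : ∀ k → seq x k ℚ.≤ seq y k ℚ.+ ½ε × seq y k ℚ.≤ seq x k ℚ.+ ½ε → ∣ seq x k ℚ.- seq y k ∣ ℚ.< ε
  step k (x≤ , y≤) = ℚ.≤-<-trans (∣-∣≤ {seq x k} {seq y k} (move x≤) (move y≤)) ½ε<ε

-- Eigenvectors

∑ℝ : Vector ℝ n → ℝ
∑ℝ = Algebra.Definitions.RawMonoid.sum (RawSemiring.+-rawMonoid ℝ-rawSemiring)

seq-+ : ∀ x y k → seq (x +ℝ y) k ≡ seq x k ℚ.+ seq y k
seq-+ x y k = refl

seq-sum : (v : Vector ℝ n) (k : ℕ) → seq (∑ℝ v) k ≡ ℚΣ.sum (λ j → seq (v j) k)
seq-sum {zero}  v k = refl
seq-sum {suc n} v k = trans (seq-+ (v zero) (∑ℝ (v ∘ suc)) k) (cong (seq (v zero) k ℚ.+_) (seq-sum (v ∘ suc) k))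

seq-entry : ∀ b x k → seq ((if b then 1ℝ else 0ℝ) *ℝ x) k ≡ 𝟙ℚ b ℚ.* seq x k
seq-entry true  x k = refl
seq-entry false x k = refl

seq-adjacency : (G : Graph n) (x : Vector ℝ n) (i : Fin n) (k : ℕ) →
  seq ((adjacencyMatrix G · x) i) k ≡ image G (λ j → seq (x j) k) i
seq-adjacency G x i k = trans (seq-sum (λ j → (if adj G i j then 1ℝ else 0ℝ) *ℝ x j) k)
  (ℚΣ.sum-cong-≗ (λ j → seq-entry (adj G i j) (x j) k))

-- With y = A x and errors e = y − r x, g = y + r x, one has r² x² = y² − g e, hence
-- c² ∑ x² ≤ ∑ y² − ∑ g e ≤ M ∑ x² − ∑ g e, where ∑ g e → 0.
approximate-eigenvector-null : (G : Graph n) (M : ℕ) → (∀ i → twoWalks G i ≤ M) →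
  (r : ℕ → ℚ) (x : ℕ → Fin n → ℚ) →
  (∀ i → EventuallyBounded (λ k → image G (x k) i ℚ.+ r k ℚ.* x k i)) →
  (∀ i → Null (λ k → image G (x k) i ℚ.- r k ℚ.* x k i)) →
  (c : ℚ) → 0ℚ ℚ.≤ c → cast M ℚ.< c ℚ.* c → Eventually (λ k → c ℚ.≤ r k) →
  ∀ i → Null (λ k → x k i)
approximate-eigenvector-null {n} G M walks≤M r x bounded eigen c 0≤c M<c² c≤r i =
  null-sqrt (null-cancel η {{pos-η}} (null-between (weaken bound c≤r) (null-neg (null-sum errors))))
  where
  η : ℚ
  η = c ℚ.* c ℚ.- cast M

  pos-η : Positive η
  pos-η = ℚ.positive (subst (ℚ._< η) (ℚ.+-inverseʳ (cast M)) (ℚ.+-monoˡ-< (ℚ.- cast M) M<c²))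

  0≤η : 0ℚ ℚ.≤ η
  0≤η = ℚ.<⇒≤ (ℚ.positive⁻¹ η {{pos-η}})

  e g : Fin n → ℕ → ℚ
  e i k = image G (x k) i ℚ.- r k ℚ.* x k i
  g i k = image G (x k) i ℚ.+ r k ℚ.* x k i

  errors : ∀ i → Null (λ k → g i k ℚ.* e i k)
  errors i = null-* {a = g i} {z = e i} (bounded i) (eigen i)

  bound : ∀ k → c ℚ.≤ r k → 0ℚ ℚ.≤ η ℚ.* (x k i ℚ.* x k i) ×
    η ℚ.* (x k i ℚ.* x k i) ℚ.≤ ℚ.- ℚΣ.sum (λ i → g i k ℚ.* e i k)
  bound k c≤rk = 0≤* 0≤η (0≤square (v i)) , (begin
    η ℚ.* (v i ℚ.* v i)             ≤⟨ ℚ.*-monoˡ-≤-nonNeg η {{ℚ.nonNegative 0≤η}} (term≤sum {f = λ i → v i ℚ.* v i} (λ i → 0≤square (v i)) i) ⟩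
    η ℚ.* S                         ≡⟨ solve 3 (λ c m s → (c :* c :- m) :* s := c :* c :* s :- m :* s) refl c (cast M) S ⟩
    c ℚ.* c ℚ.* S ℚ.- cast M ℚ.* S  ≤⟨ ℚ.+-mono-≤ c²S≤ (ℚ.neg-antimono-≤ (image-norm G M walks≤M v)) ⟩
    Y ℚ.- E ℚ.- Y                   ≡⟨ solve 2 (λ y e → y :- e :- y := :- e) refl Y E ⟩
    ℚ.- E                           ∎)
    where
    open ℚ.≤-Reasoning
    open +-*-Solver
    v : Fin n → ℚ
    v = x k
    ρ = r k
    S = squareNorm v
    Y = squareNorm (image G v)
    E = ℚΣ.sum (λ i → g i k ℚ.* e i k)

    term : ∀ i → image G v i ℚ.* image G v i ≡ ρ ℚ.* ρ ℚ.* (v i ℚ.* v i) ℚ.+ g i k ℚ.* e i k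
    term i = solve 3 (λ y r x → y :* y := r :* r :* (x :* x) :+ (y :+ r :* x) :* (y :- r :* x)) refl (image G v i) ρ (v i)

    Y≡ : Y ≡ ρ ℚ.* ρ ℚ.* S ℚ.+ E
    Y≡ = trans (ℚΣ.sum-cong-≗ term) (trans
      (ℚΣ⁺.∑-distrib-+ (λ i → ρ ℚ.* ρ ℚ.* (v i ℚ.* v i)) (λ i → g i k ℚ.* e i k))
      (cong (ℚ._+ E) (sym (ℚΣ.*-distribˡ-sum (ρ ℚ.* ρ) (λ i → v i ℚ.* v i)))))

    c²S≤ : c ℚ.* c ℚ.* S ℚ.≤ Y ℚ.- E
    c²S≤ = begin
      c ℚ.* c ℚ.* S            ≤⟨ ℚ.*-monoʳ-≤-nonNeg S {{ℚ.nonNegative (0≤sum (λ i → 0≤square (v i)))}} (*-mono-≤ 0≤c 0≤c c≤rk c≤rk) ⟩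
      ρ ℚ.* ρ ℚ.* S            ≡⟨ solve 2 (λ a e → a := a :+ e :- e) refl (ρ ℚ.* ρ ℚ.* S) E ⟩
      ρ ℚ.* ρ ℚ.* S ℚ.+ E ℚ.- E ≡⟨ cong (ℚ._- E) Y≡ ⟨
      Y ℚ.- E                  ∎

bounded-cong : ∀ {w z} → (∀ k → w k ≡ z k) → EventuallyBounded z → EventuallyBounded w
bounded-cong eq (B , posB , N , bound) = B , posB , N , λ k N≤k →
  subst (λ q → ∣ q ∣ ℚ.≤ B) (sym (eq k)) (bound k N≤k)

-- The terms of `(adjacencyMatrix G · x) i` agree with the rational `image` propositionally, not by
-- computation. These lemmas carry bounds and limits across that equality.
module _ (y r x : ℝ) (Y : ℕ → ℚ) (y≡Y : ∀ k → seq y k ≡ Y k) where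

  sum-bounded : EventuallyBounded (λ k → Y k ℚ.+ seq r k ℚ.* seq x k)
  sum-bounded = bounded-cong (λ k → cong (ℚ._+ seq r k ℚ.* seq x k) (sym (y≡Y k)))
    (eventually-bounded {λ k → seq y k ℚ.+ seq r k ℚ.* seq x k} (cauchy (y +ℝ r *ℝ x)))

  difference-null : y ≃ r *ℝ x → Null (λ k → Y k ℚ.- seq r k ℚ.* seq x k)
  difference-null = null-cong (λ k → cong (ℚ._- seq r k ℚ.* seq x k) (sym (y≡Y k)))

  difference-null⁻¹ : Null (λ k → Y k ℚ.- seq r k ℚ.* seq x k) → y ≃ r *ℝ x
  difference-null⁻¹ = null-cong (λ k → cong (ℚ._- seq r k ℚ.* seq x k) (y≡Y k))

image-cong : (G : Graph n) (u v : Fin n → ℚ) → (∀ j → u j ≡ v j) → ∀ i → image G u i ≡ image G v i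
image-cong G u v u≡v i = ℚΣ.sum-cong-≗ (λ j → cong (𝟙ℚ (adj G i j) ℚ.*_) (u≡v j))

approximate-eigenvector : (G : Graph n) (r : ℝ) (x : Vector ℝ n) (v : ℕ → Fin n → ℚ) →
  (∀ j k → seq (x j) k ≡ v k j) →
  (∀ i → Null (λ k → image G (v k) i ℚ.- seq r k ℚ.* v k i)) →
  ∀ i → (adjacencyMatrix G · x) i ≃ r *ℝ x i
approximate-eigenvector {n} G r x v x≡v null i =
  difference-null⁻¹ ((adjacencyMatrix G · x) i) r (x i) (λ k → image G (u k) i) (seq-adjacency G x i) difference
  where
  u : ℕ → Fin n → ℚ
  u k j = seq (x j) k
  difference : Null (λ k → image G (u k) i ℚ.- seq r k ℚ.* u k i)
  difference = null-cong
    (λ k → cong₂ (λ e f → e ℚ.- seq r k ℚ.* f) (image-cong G (u k) (v k) (λ j → x≡v j k) i) (x≡v i k)) (null i)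

-- The usable form of ρ(G)² ≤ M: an eigenvalue eventually above such a `c` would have only the zero
-- vector, contradicting `IsEigenvalue`.
eigenvector-null : (G : Graph n) (M : ℕ) → (∀ i → twoWalks G i ≤ M) →
  (r : ℝ) (x : Vector ℝ n) → (∀ i → (adjacencyMatrix G · x) i ≃ r *ℝ x i) →
  (c : ℚ) → 0ℚ ℚ.≤ c → cast M ℚ.< c ℚ.* c → Eventually (λ k → c ℚ.≤ seq r k) →
  ∀ i → x i ≃ 0ℝ
eigenvector-null {n} G M walks≤M r x eigen c 0≤c M<c² c≤r i =
  null-cong (λ k → ℚ.+-identityʳ (seq (x i) k))
    (approximate-eigenvector-null G M walks≤M (seq r) v
      (λ i → sum-bounded ((adjacencyMatrix G · x) i) r (x i) (λ k → image G (v k) i) (seq-adjacency G x i))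
      (λ i → difference-null ((adjacencyMatrix G · x) i) r (x i) (λ k → image G (v k) i) (seq-adjacency G x i) (eigen i))
      c 0≤c M<c² c≤r i)
  where
  v : ℕ → Fin n → ℚ
  v k j = seq (x j) k

-- Bisection

toℚᵘ-cast : ∀ m → ℚ.toℚᵘ (cast m) ℚᵘ.≃ ℚᵘ.mkℚᵘ (ℤ.+ m) 0
toℚᵘ-cast zero    = ℚᵘ.≃-refl
toℚᵘ-cast (suc m) = ℚᵘ.≃-trans (ℚ.toℚᵘ-homo-+ 1ℚ (cast m))
  (ℚᵘ.≃-trans (ℚᵘ.+-congʳ (ℚ.toℚᵘ 1ℚ) (toℚᵘ-cast m)) (ℚᵘ.*≡* (cong (λ i → (ℤ.1ℤ ℤ.+ i) ℤ.* ℤ.1ℤ) (ℤ.*-identityʳ (ℤ.+ m)))))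

-- The denominator is at least 1, so the absolute value of the numerator is an upper bound.
archimedean : ∀ p → ∃[ N ] p ℚ.≤ cast N
archimedean p = ℤ.∣ ℚ.↥ p ∣ , ℚ.toℚᵘ-cancel-≤ (ℚᵘ.≤-respʳ-≃ (ℚᵘ.≃-sym (toℚᵘ-cast ℤ.∣ ℚ.↥ p ∣)) (bound p))
  where
  bound : ∀ p → ℚ.toℚᵘ p ℚᵘ.≤ ℚᵘ.mkℚᵘ (ℤ.+ ℤ.∣ ℚ.↥ p ∣) 0
  bound (mkℚ (ℤ.+ m) d _)    = ℚᵘ.*≤* (ℤ.*-monoˡ-≤-nonNeg (ℤ.+ m) (ℤ.+≤+ (s≤s z≤n)))
  bound (mkℚ ℤ.-[1+ m ] d _) = ℚᵘ.*≤* ℤ.-≤+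

halfPow : ℕ → ℚ
halfPow zero    = 1ℚ
halfPow (suc k) = ½ ℚ.* halfPow k

pos-halfPow : ∀ k → Positive (halfPow k)
pos-halfPow zero    = _
pos-halfPow (suc k) = half-pos (halfPow k) {{pos-halfPow k}}

0≤halfPow : ∀ k → 0ℚ ℚ.≤ halfPow k
0≤halfPow k = ℚ.<⇒≤ (ℚ.positive⁻¹ (halfPow k) {{pos-halfPow k}})

halfPow-≤1 : ∀ k → halfPow k ℚ.≤ 1ℚ
halfPow-≤1 zero    = ℚ.≤-refl
halfPow-≤1 (suc k) = ℚ.≤-trans (½≤ (0≤halfPow k)) (halfPow-≤1 k)

cast-halfPow-≤1 : ∀ k → cast k ℚ.* halfPow k ℚ.≤ 1ℚ
cast-halfPow-≤1 zero    = 0≤1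
cast-halfPow-≤1 (suc k) = begin
  (1ℚ ℚ.+ cast k) ℚ.* (½ ℚ.* halfPow k)     ≡⟨ solve 3 (λ h c x → (con 1ℚ :+ c) :* (h :* x) := h :* (x :+ c :* x)) refl ½ (cast k) (halfPow k) ⟩
  ½ ℚ.* (halfPow k ℚ.+ cast k ℚ.* halfPow k) ≤⟨ ℚ.*-monoˡ-≤-nonNeg ½ (ℚ.+-mono-≤ (halfPow-≤1 k) (cast-halfPow-≤1 k)) ⟩
  1ℚ                                        ∎
  where open ℚ.≤-Reasoning
        open +-*-Solver

halfPow-antitone : ∀ {N k} → N ≤ k → halfPow k ℚ.≤ halfPow N
halfPow-antitone {N} N≤k with ℕ.m≤n⇒∃[o]m+o≡n N≤k
... | o , refl = go o
  where
  go : ∀ o → halfPow (N + o) ℚ.≤ halfPow N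
  go zero    rewrite ℕ.+-identityʳ N = ℚ.≤-refl
  go (suc o) rewrite ℕ.+-suc N o = ℚ.≤-trans (½≤ (0≤halfPow (N + o))) (go o)

-- 1/ε < N and N 2⁻ᴺ ≤ 1 give 2⁻ᴺ < ε.
null-halfPow : Null halfPow
null-halfPow ε {{posε}} = N , λ k N≤k → subst (ℚ._< ε) (sym (ℚ.0≤p⇒∣p∣≡p (0≤halfPow k)))
    (ℚ.≤-<-trans (halfPow-antitone N≤k) small)
  where
  instance _ = ℚ.pos⇒nonZero ε
  arch = archimedean (ℚ.1/ ε ℚ.+ 1ℚ)
  N = proj₁ arch
  large : 1ℚ ℚ.< ε ℚ.* cast N
  large = begin-strict
    1ℚ                          ≡⟨ ℚ.*-inverseʳ ε ⟨
    ε ℚ.* (ℚ.1/ ε)              ≡⟨ cong (ε ℚ.*_) (ℚ.+-identityʳ (ℚ.1/ ε)) ⟨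
    ε ℚ.* (ℚ.1/ ε ℚ.+ 0ℚ)       <⟨ ℚ.*-monoʳ-<-pos ε (ℚ.+-monoʳ-< (ℚ.1/ ε) (ℚ.positive⁻¹ 1ℚ)) ⟩
    ε ℚ.* (ℚ.1/ ε ℚ.+ 1ℚ)       ≤⟨ ℚ.*-monoˡ-≤-nonNeg ε {{ℚ.pos⇒nonNeg ε}} (proj₂ arch) ⟩
    ε ℚ.* cast N                ∎
    where open ℚ.≤-Reasoning
  small : halfPow N ℚ.< ε
  small = ℚ.≰⇒> λ ε≤h → ℚ.<-irrefl refl (ℚ.<-≤-trans large (ℚ.≤-trans
    (ℚ.*-monoʳ-≤-nonNeg (cast N) {{ℚ.nonNegative (0≤cast N)}} ε≤h)
    (ℚ.≤-trans (ℚ.≤-reflexive (ℚ.*-comm (halfPow N) (cast N))) (cast-halfPow-≤1 N))))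

-- Only values at rationals are compared, so each halving is decidable. A one-sided Lipschitz bound
-- suffices: f is at most 0 at the lower end and at least 0 at the upper end, hence 0 ≤ f hi ≤ f hi
-- - f lo ≤ L (hi - lo).
module Bisection (f : ℚ → ℚ) (a b L : ℚ) (a≤b : a ℚ.≤ b) (0≤L : 0ℚ ℚ.≤ L)
  (f-a : f a ℚ.≤ 0ℚ) (f-b : 0ℚ ℚ.≤ f b)
  (lipschitz : ∀ s t → a ℚ.≤ s → s ℚ.≤ t → t ℚ.≤ b → f t ℚ.- f s ℚ.≤ L ℚ.* (t ℚ.- s)) where

  record Bracket : Set where
    field
      lo hi : ℚ
      a≤lo  : a ℚ.≤ lo
      lo≤hi : lo ℚ.≤ hi
      hi≤b  : hi ℚ.≤ b
      f-lo  : f lo ℚ.≤ 0ℚ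
      f-hi  : 0ℚ ℚ.≤ f hi

  open Bracket

  mid : Bracket → ℚ
  mid I = ½ ℚ.* (lo I ℚ.+ hi I)

  lo≤mid : ∀ I → lo I ℚ.≤ mid I
  lo≤mid I = subst (ℚ._≤ mid I) (½* (lo I)) (ℚ.*-monoˡ-≤-nonNeg ½ (ℚ.+-monoʳ-≤ (lo I) (lo≤hi I)))

  mid≤hi : ∀ I → mid I ℚ.≤ hi I
  mid≤hi I = subst (mid I ℚ.≤_) (½* (hi I)) (ℚ.*-monoˡ-≤-nonNeg ½ (ℚ.+-monoˡ-≤ (hi I) (lo≤hi I)))

  halve : Bracket → Bracket
  halve I with ℚ.≤-total (f (mid I)) 0ℚ
  ... | inj₁ f≤0 = record { lo = mid I ; hi = hi I ; a≤lo = ℚ.≤-trans (a≤lo I) (lo≤mid I)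
                          ; lo≤hi = mid≤hi I ; hi≤b = hi≤b I ; f-lo = f≤0 ; f-hi = f-hi I }
  ... | inj₂ 0≤f = record { lo = lo I ; hi = mid I ; a≤lo = a≤lo I
                          ; lo≤hi = lo≤mid I ; hi≤b = ℚ.≤-trans (mid≤hi I) (hi≤b I) ; f-lo = f-lo I ; f-hi = 0≤f }

  halve-width : ∀ I → hi (halve I) ℚ.- lo (halve I) ≡ ½ ℚ.* (hi I ℚ.- lo I)
  halve-width I with ℚ.≤-total (f (mid I)) 0ℚ
  ... | inj₁ _ = trans (cong (ℚ._- mid I) (sym (½* (hi I))))
      (solve 3 (λ c l h → c :* (h :+ h) :- c :* (l :+ h) := c :* (h :- l)) refl ½ (lo I) (hi I))
    where open +-*-Solver
  ... | inj₂ _ = trans (cong (λ l → mid I ℚ.- l) (sym (½* (lo I))))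
      (solve 3 (λ c l h → c :* (l :+ h) :- c :* (l :+ l) := c :* (h :- l)) refl ½ (lo I) (hi I))
    where open +-*-Solver

  halve-lo : ∀ I → lo I ℚ.≤ lo (halve I)
  halve-lo I with ℚ.≤-total (f (mid I)) 0ℚ
  ... | inj₁ _ = lo≤mid I
  ... | inj₂ _ = ℚ.≤-refl

  halve-hi : ∀ I → hi (halve I) ℚ.≤ hi I
  halve-hi I with ℚ.≤-total (f (mid I)) 0ℚ
  ... | inj₁ _ = ℚ.≤-refl
  ... | inj₂ _ = mid≤hi I

  bracket : ℕ → Bracket
  bracket zero    = record { lo = a ; hi = b ; a≤lo = ℚ.≤-refl ; lo≤hi = a≤b ; hi≤b = ℚ.≤-refl ; f-lo = f-a ; f-hi = f-b }
  bracket (suc k) = halve (bracket k)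

  width : ℕ → ℚ
  width k = hi (bracket k) ℚ.- lo (bracket k)

  width-halfPow : ∀ k → width k ≡ (b ℚ.- a) ℚ.* halfPow k
  width-halfPow zero    = sym (ℚ.*-identityʳ (b ℚ.- a))
  width-halfPow (suc k) = trans (halve-width (bracket k)) (trans (cong (½ ℚ.*_) (width-halfPow k))
    (solve 3 (λ c w h → c :* (w :* h) := w :* (c :* h)) refl ½ (b ℚ.- a) (halfPow k)))
    where open +-*-Solver

  null-width : Null width
  null-width = null-cong width-halfPow (null-scale (b ℚ.- a) null-halfPow)

  nested : ∀ {N k} → N ≤ k → lo (bracket N) ℚ.≤ lo (bracket k) × hi (bracket k) ℚ.≤ hi (bracket N)
  nested {N} N≤k with ℕ.m≤n⇒∃[o]m+o≡n N≤k
  ... | o , refl = go o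
    where
    go : ∀ o → lo (bracket N) ℚ.≤ lo (bracket (N + o)) × hi (bracket (N + o)) ℚ.≤ hi (bracket N)
    go zero    rewrite ℕ.+-identityʳ N = ℚ.≤-refl , ℚ.≤-refl
    go (suc o) rewrite ℕ.+-suc N o = ℚ.≤-trans (proj₁ (go o)) (halve-lo (bracket (N + o)))
                                   , ℚ.≤-trans (halve-hi (bracket (N + o))) (proj₂ (go o))

  -- The upper ends are taken as the terms of the root because f is nonnegative at each of them; the
  -- later lower bound on t² needs this sign at every term, not only in the limit.
  upper : ℕ → ℚ
  upper k = hi (bracket k)

  a≤upper : ∀ k → a ℚ.≤ upper k
  a≤upper k = ℚ.≤-trans (a≤lo (bracket k)) (lo≤hi (bracket k))

  upper≤b : ∀ k → upper k ℚ.≤ b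
  upper≤b k = hi≤b (bracket k)

  0≤f-upper : ∀ k → 0ℚ ℚ.≤ f (upper k)
  0≤f-upper k = f-hi (bracket k)

  null-f-upper : Null (λ k → f (upper k))
  null-f-upper = null-between (0 , λ k _ → 0≤f-upper k , bound k) (null-scale L null-width)
    where
    bound : ∀ k → f (upper k) ℚ.≤ L ℚ.* width k
    bound k = begin
      f (upper k)              ≡⟨ ℚ.+-identityʳ (f (upper k)) ⟨
      f (upper k) ℚ.+ 0ℚ       ≤⟨ ℚ.+-monoʳ-≤ (f (upper k)) (ℚ.neg-antimono-≤ (f-lo (bracket k))) ⟩
      f (upper k) ℚ.- f (lo (bracket k)) ≤⟨ lipschitz (lo (bracket k)) (upper k) (a≤lo (bracket k)) (lo≤hi (bracket k)) (upper≤b k) ⟩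
      L ℚ.* width k            ∎
      where open ℚ.≤-Reasoning

  upper-cauchy : IsCauchy upper
  upper-cauchy ε = N , λ m n N≤m N≤n → ℚ.≤-<-trans (close m n N≤m N≤n)
      (ℚ.≤-<-trans (ℚ.≤-reflexive (sym (ℚ.0≤p⇒∣p∣≡p (0≤- (lo≤hi (bracket N)))))) (proj₂ (null-width ε) N ℕ.≤-refl))
    where
    N = proj₁ (null-width ε)
    one-sided : ∀ m n → N ≤ m → N ≤ n → upper m ℚ.- upper n ℚ.≤ width N
    one-sided m n N≤m N≤n = ℚ.+-mono-≤ (proj₂ (nested N≤m))
      (ℚ.neg-antimono-≤ (ℚ.≤-trans (proj₁ (nested N≤n)) (lo≤hi (bracket n))))
    close : ∀ m n → N ≤ m → N ≤ n → ∣ upper m ℚ.- upper n ∣ ℚ.≤ width N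
    close m n N≤m N≤n = ∣-∣≤ {upper m} {upper n} (one-sided m n N≤m N≤n) (one-sided n m N≤n N≤m)

  root : ℝ
  root = mkℝ upper upper-cauchy

-- The eigenvalue of a complete bipartite graph minus an edge

byColour : (Colour → ℕ) → (Colour → ℚ) → ℚ
byColour N F = cast (N (true , true)) ℚ.* F (true , true) ℚ.+ (cast (N (true , false)) ℚ.* F (true , false)
  ℚ.+ (cast (N (false , true)) ℚ.* F (false , true) ℚ.+ cast (N (false , false)) ℚ.* F (false , false)))

-- Reduces the eigenvector equation on n vertices to one in four unknowns, since both the entries
-- and the adjacencies depend only on colours.
sum-byColour : (c : Fin n → Colour) (F : Colour → ℚ) →
  ℚΣ.sum (F ∘ c) ≡ byColour (multiplicity _≟ᶜ_ c) F
sum-byColour {zero} c F = solve 4 (λ p q r s →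
  con 0ℚ := con 0ℚ :* p :+ (con 0ℚ :* q :+ (con 0ℚ :* r :+ con 0ℚ :* s))) refl
  (F (true , true)) (F (true , false)) (F (false , true)) (F (false , false))
  where open +-*-Solver
sum-byColour {suc n} c F = trans (cong (F (c zero) ℚ.+_) (sum-byColour (c ∘ suc) F))
  (extra (c zero) (multiplicity _≟ᶜ_ (c ∘ suc)))
  where
  open +-*-Solver
  extra : ∀ δ N → F δ ℚ.+ byColour N F ≡ byColour (λ γ → 𝟙 ⌊ δ ≟ᶜ γ ⌋ + N γ) F
  extra δ N = go δ
    where
    p q r s x y z w : ℚ
    p = cast (N (true , true))
    q = cast (N (true , false))
    r = cast (N (false , true))
    s = cast (N (false , false))
    x = F (true , true)
    y = F (true , false)
    z = F (false , true)
    w = F (false , false)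
    go : ∀ δ → F δ ℚ.+ byColour N F ≡ byColour (λ γ → 𝟙 ⌊ δ ≟ᶜ γ ⌋ + N γ) F
    go (true , true) = solve 3 (λ p x r → x :+ (p :* x :+ r) := (con 1ℚ :+ p) :* x :+ r) refl
      p x (q ℚ.* y ℚ.+ (r ℚ.* z ℚ.+ s ℚ.* w))
    go (true , false) = solve 4 (λ a p x r → x :+ (a :+ (p :* x :+ r)) := a :+ ((con 1ℚ :+ p) :* x :+ r)) refl
      (p ℚ.* x) q y (r ℚ.* z ℚ.+ s ℚ.* w)
    go (false , true) = solve 5 (λ a b p x r → x :+ (a :+ (b :+ (p :* x :+ r))) := a :+ (b :+ ((con 1ℚ :+ p) :* x :+ r))) refl
      (p ℚ.* x) (q ℚ.* y) r z (s ℚ.* w)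
    go (false , false) = solve 5 (λ a b c p x → x :+ (a :+ (b :+ (c :+ p :* x))) := a :+ (b :+ (c :+ (con 1ℚ :+ p) :* x))) refl
      (p ℚ.* x) (q ℚ.* y) (r ℚ.* z) s w

module _ (α β : ℚ) where

  -- The characteristic polynomial of the 4 by 4 quotient matrix of the colour classes. For p = 1 +
  -- α and q = 1 + β the coefficient α + β + αβ is p q - 1, and μ is t².
  quartic : ℚ → ℚ
  quartic t = t ℚ.* t ℚ.* (t ℚ.* t) ℚ.- (α ℚ.+ β ℚ.+ α ℚ.* β) ℚ.* (t ℚ.* t) ℚ.+ α ℚ.* β

  -- Solves A x = t x up to multiples of quartic t, for parts of sizes 1 + α (first) and 1 + β.
  entryℚ : ℚ → Colour → ℚ
  entryℚ t (true  , true)  = β ℚ.* (t ℚ.* t)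
  entryℚ t (true  , false) = (1ℚ ℚ.+ β) ℚ.* (t ℚ.* t) ℚ.+ ℚ.- β
  entryℚ t (false , true)  = t ℚ.* (t ℚ.* t) ℚ.+ (ℚ.- β) ℚ.* t
  entryℚ t (false , false) = t ℚ.* (t ℚ.* t)

  -- The same formulas in real arithmetic, so that the operations on ℝ supply the Cauchy property of
  -- each entry.
  entry : ℝ → Colour → ℝ
  entry t (true  , true)  = fromℚ β *ℝ (t *ℝ t)
  entry t (true  , false) = fromℚ (1ℚ ℚ.+ β) *ℝ (t *ℝ t) +ℝ fromℚ (ℚ.- β)
  entry t (false , true)  = t *ℝ (t *ℝ t) +ℝ fromℚ (ℚ.- β) *ℝ t
  entry t (false , false) = t *ℝ (t *ℝ t)

  seq-entryℚ : ∀ t γ k → seq (entry t γ) k ≡ entryℚ (seq t k) γ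
  seq-entryℚ t (true  , true)  k = refl
  seq-entryℚ t (true  , false) k = refl
  seq-entryℚ t (false , true)  k = refl
  seq-entryℚ t (false , false) k = refl

  -- The entries are chosen so that the equations at the first side are identities in t; only those
  -- at the second side require a root.
  residual : ℚ → Colour → ℚ
  residual t (true  , _) = 0ℚ
  residual t (false , _) = ℚ.- quartic t

  residual-equation : ∀ t γ →
    1ℚ ℚ.* (𝟙ℚ (joined γ (true , true)) ℚ.* entryℚ t (true , true)) ℚ.+
    (α ℚ.* (𝟙ℚ (joined γ (true , false)) ℚ.* entryℚ t (true , false)) ℚ.+
    (1ℚ ℚ.* (𝟙ℚ (joined γ (false , true)) ℚ.* entryℚ t (false , true)) ℚ.+
    β ℚ.* (𝟙ℚ (joined γ (false , false)) ℚ.* entryℚ t (false , false)))) ℚ.- t ℚ.* entryℚ t γ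
    ≡ residual t γ
  residual-equation t (true , true) = solve 3 (λ a b t →
    con 1ℚ :* (con 0ℚ :* (b :* (t :* t))) :+ (a :* (con 0ℚ :* ((con 1ℚ :+ b) :* (t :* t) :+ :- b))
    :+ (con 1ℚ :* (con 0ℚ :* (t :* (t :* t) :+ (:- b) :* t)) :+ b :* (con 1ℚ :* (t :* (t :* t)))))
    :- t :* (b :* (t :* t)) := con 0ℚ) refl α β t
    where open +-*-Solver
  residual-equation t (true , false) = solve 3 (λ a b t →
    con 1ℚ :* (con 0ℚ :* (b :* (t :* t))) :+ (a :* (con 0ℚ :* ((con 1ℚ :+ b) :* (t :* t) :+ :- b))
    :+ (con 1ℚ :* (con 1ℚ :* (t :* (t :* t) :+ (:- b) :* t)) :+ b :* (con 1ℚ :* (t :* (t :* t)))))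
    :- t :* ((con 1ℚ :+ b) :* (t :* t) :+ :- b) := con 0ℚ) refl α β t
    where open +-*-Solver
  residual-equation t (false , true) = solve 3 (λ a b t →
    con 1ℚ :* (con 0ℚ :* (b :* (t :* t))) :+ (a :* (con 1ℚ :* ((con 1ℚ :+ b) :* (t :* t) :+ :- b))
    :+ (con 1ℚ :* (con 0ℚ :* (t :* (t :* t) :+ (:- b) :* t)) :+ b :* (con 0ℚ :* (t :* (t :* t)))))
    :- t :* (t :* (t :* t) :+ (:- b) :* t)
    := :- (t :* t :* (t :* t) :- (a :+ b :+ a :* b) :* (t :* t) :+ a :* b)) refl α β t
    where open +-*-Solver
  residual-equation t (false , false) = solve 3 (λ a b t →
    con 1ℚ :* (con 1ℚ :* (b :* (t :* t))) :+ (a :* (con 1ℚ :* ((con 1ℚ :+ b) :* (t :* t) :+ :- b))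
    :+ (con 1ℚ :* (con 0ℚ :* (t :* (t :* t) :+ (:- b) :* t)) :+ b :* (con 0ℚ :* (t :* (t :* t)))))
    :- t :* (t :* (t :* t))
    := :- (t :* t :* (t :* t) :- (a :+ b :+ a :* b) :* (t :* t) :+ a :* b)) refl α β t
    where open +-*-Solver

module _ {G : Graph n} {a b : ℕ} (B : BipartiteMinusEdge G (suc a) (suc b)) where

  open BipartiteMinusEdge B

  image-entryℚ : ∀ t i → image G (λ j → entryℚ (cast a) (cast b) t (colour j)) i
    ℚ.- t ℚ.* entryℚ (cast a) (cast b) t (colour i) ≡ residual (cast a) (cast b) t (colour i)
  image-entryℚ t i = trans
    (cong (ℚ._- t ℚ.* entryℚ (cast a) (cast b) t (colour i)) (begin
      image G (λ j → entryℚ (cast a) (cast b) t (colour j)) i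
        ≡⟨ ℚΣ.sum-cong-≗ (λ j → cong (λ e → 𝟙ℚ e ℚ.* entryℚ (cast a) (cast b) t (colour j)) (adj-joined i j)) ⟩
      ℚΣ.sum (F ∘ colour)
        ≡⟨ sum-byColour colour F ⟩
      byColour (multiplicity _≟ᶜ_ colour) F
        ≡⟨ counts #left-end (ℕ.suc-injective #left-other) #right-end (ℕ.suc-injective #right-other) ⟩
      1ℚ ℚ.* F (true , true) ℚ.+ (cast a ℚ.* F (true , false) ℚ.+ (1ℚ ℚ.* F (false , true) ℚ.+ cast b ℚ.* F (false , false)))
        ∎))
    (residual-equation (cast a) (cast b) t (colour i))
    where
    open ≡-Reasoning
    F : Colour → ℚ
    F δ = 𝟙ℚ (joined (colour i) δ) ℚ.* entryℚ (cast a) (cast b) t δ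
    counts : ∀ {p q r s p′ q′ r′ s′} → p ≡ p′ → q ≡ q′ → r ≡ r′ → s ≡ s′ →
      cast p ℚ.* F (true , true) ℚ.+ (cast q ℚ.* F (true , false) ℚ.+ (cast r ℚ.* F (false , true) ℚ.+ cast s ℚ.* F (false , false)))
      ≡ cast p′ ℚ.* F (true , true) ℚ.+ (cast q′ ℚ.* F (true , false) ℚ.+ (cast r′ ℚ.* F (false , true) ℚ.+ cast s′ ℚ.* F (false , false)))
    counts refl refl refl refl = refl

  quartic-root⇒eigenvalue : (r : ℝ) → (∀ k → 1ℚ ℚ.≤ seq r k) →
    Null (λ k → quartic (cast a) (cast b) (seq r k)) → IsEigenvalue (adjacencyMatrix G) r
  quartic-root⇒eigenvalue r 1≤r null-quartic = x , nonzero , eigen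
    where
    x : Vector ℝ n
    x i = entry (cast a) (cast b) r (colour i)

    t : ℕ → ℚ
    t = seq r

    null-residual : ∀ γ → Null (λ k → residual (cast a) (cast b) (t k) γ)
    null-residual (true  , _) = null-0
    null-residual (false , _) = null-neg null-quartic

    eigen : ∀ i → (adjacencyMatrix G · x) i ≃ r *ℝ x i
    eigen = approximate-eigenvector G r x (λ k j → entryℚ (cast a) (cast b) (t k) (colour j))
      (λ j k → seq-entryℚ (cast a) (cast b) r (colour j) k)
      (λ i → null-cong (λ k → image-entryℚ (t k) i) (null-residual (colour i)))

    far-from-0 : ∀ y → (∀ k → 1ℚ ℚ.≤ seq y k) → ¬ (y ≃ 0ℝ)
    far-from-0 y 1≤y y≃0 with y≃0 1ℚ
    ... | N , close = ℚ.<-irrefl refl (ℚ.≤-<-trans (1≤y N)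
        (∣p∣<ε⇒p<ε (subst (λ q → ∣ q ∣ ℚ.< 1ℚ) (ℚ.+-identityʳ (seq y N)) (close N ℕ.≤-refl))))

    1≤* : ∀ {p q} → 1ℚ ℚ.≤ p → 1ℚ ℚ.≤ q → 1ℚ ℚ.≤ p ℚ.* q
    1≤* = *-mono-≤ 0≤1 0≤1

    colour-left : colour left ≡ (true , true)
    colour-left = cong₂ _,_ side-left (cong (_∨ (left == right)) (==-refl left))

    colour-right : colour right ≡ (false , true)
    colour-right = cong₂ _,_ side-right (trans (cong ((right == left) ∨_) (==-refl right)) (Bool.∨-zeroʳ (right == left)))

    nonzero : ¬ (∀ i → x i ≃ 0ℝ)
    -- The left end carries β t², which is at least 1 unless β = 0. In that case the right end
    -- carries t³, which is at least 1.
    nonzero = no-zero b refl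
      where
      no-zero : ∀ b′ → b′ ≡ b → ¬ (∀ i → x i ≃ 0ℝ)
      no-zero zero refl x≃0 = far-from-0 (entry (cast a) 0ℚ r (false , true))
        (λ k → subst (1ℚ ℚ.≤_) (cubic (t k)) (1≤* (1≤r k) (1≤* (1≤r k) (1≤r k))))
        (subst (λ γ → entry (cast a) 0ℚ r γ ≃ 0ℝ) colour-right (x≃0 right))
        where
        cubic : ∀ t → t ℚ.* (t ℚ.* t) ≡ entryℚ (cast a) 0ℚ t (false , true)
        cubic t = sym (trans (cong (t ℚ.* (t ℚ.* t) ℚ.+_) (ℚ.*-zeroˡ t)) (ℚ.+-identityʳ _))
      no-zero (suc b) refl x≃0 = far-from-0 (entry (cast a) (cast (suc b)) r (true , true))
        (λ k → 1≤* (≤-gap (cast b) (0≤cast b) refl) (1≤* (1≤r k) (1≤r k)))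
        (subst (λ γ → entry (cast a) (cast (suc b)) r γ ≃ 0ℝ) colour-left (x≃0 left))

module QuarticRoot (a b M : ℕ) (1≤a+b : 1 ≤ a + b) (product : suc a * suc b ≡ 2 + M) where

  private
    α β S U L : ℚ
    α = cast a
    β = cast b
    S = α ℚ.+ β ℚ.+ α ℚ.* β
    -- `U` is (1 + α)(1 + β) = p q, a crude upper end of the bracket. `L` is 2U · 2U², which bounds
    -- the factor (t + s)(t² + s²) of t⁴ - s⁴; the quadratic term only decreases and is dropped.
    U = 1ℚ ℚ.+ S
    L = (U ℚ.+ U) ℚ.* (U ℚ.* U ℚ.+ U ℚ.* U)

    f : ℚ → ℚ
    f = quartic α β

    0≤αβ : 0ℚ ℚ.≤ α ℚ.* β
    0≤αβ = 0≤* (0≤cast a) (0≤cast b)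

    0≤S : 0ℚ ℚ.≤ S
    0≤S = 0≤+ (0≤+ (0≤cast a) (0≤cast b)) 0≤αβ

    1≤U : 1ℚ ℚ.≤ U
    1≤U = ≤-gap S 0≤S refl

    0≤U : 0ℚ ℚ.≤ U
    0≤U = ℚ.≤-trans 0≤1 1≤U

    1≤α+β : 1ℚ ℚ.≤ α ℚ.+ β
    1≤α+β = ℚ.≤-trans (cast-mono 1≤a+b) (ℚ.≤-reflexive (cast-+ a b))

    S≡1+M : S ≡ 1ℚ ℚ.+ cast M
    S≡1+M = trans (cong₂ ℚ._+_ (sym (cast-+ a b)) (sym (cast-* a b)))
      (trans (sym (cast-+ (a + b) (a * b))) (cong cast a+b+ab≡1+M))
      where
      open Data.Nat.Solver.+-*-Solver
      a+b+ab≡1+M : a + b + a * b ≡ suc M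
      a+b+ab≡1+M = ℕ.suc-injective (trans
        (solve 2 (λ a b → con 1 :+ (a :+ b :+ a :* b) := (con 1 :+ a) :* (con 1 :+ b)) refl a b) product)

    -- The value is 1 - (α + β). Its sign places one root μ at most 1 and the other at least 1, so
    -- bisection upwards from 1 finds the larger one.
    f-1 : f 1ℚ ℚ.≤ 0ℚ
    f-1 = ≤-gap (α ℚ.+ β ℚ.- 1ℚ) (0≤- 1≤α+β) (solve 2 (λ a b →
      con 0ℚ := con 1ℚ :* con 1ℚ :* (con 1ℚ :* con 1ℚ) :- (a :+ b :+ a :* b) :* (con 1ℚ :* con 1ℚ) :+ a :* b
        :+ (a :+ b :- con 1ℚ)) refl α β)
      where open +-*-Solver

    f-U : 0ℚ ℚ.≤ f U
    f-U = subst (0ℚ ℚ.≤_) (solve 2 (λ s p →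
        let u = con 1ℚ :+ s in u :* u :* (u :+ s :* s) :+ p
          := u :* u :* (u :* u) :- s :* (u :* u) :+ p) refl S (α ℚ.* β))
      (0≤+ (0≤* (0≤* 0≤U 0≤U) (0≤+ 0≤U (0≤* 0≤S 0≤S))) 0≤αβ)
      where open +-*-Solver

    f-lipschitz : ∀ s t → 1ℚ ℚ.≤ s → s ℚ.≤ t → t ℚ.≤ U → f t ℚ.- f s ℚ.≤ L ℚ.* (t ℚ.- s)
    f-lipschitz s t 1≤s s≤t t≤U = ≤-gap ((t ℚ.- s) ℚ.* (L ℚ.- K ℚ.+ (t ℚ.+ s) ℚ.* S))
      (0≤* (0≤- s≤t) (0≤+ (0≤- K≤L) (0≤* (0≤+ 0≤t 0≤s) 0≤S)))
      (solve 5 (λ s t l c p →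
        l :* (t :- s) := (t :* t :* (t :* t) :- c :* (t :* t) :+ p) :- (s :* s :* (s :* s) :- c :* (s :* s) :+ p)
          :+ (t :- s) :* (l :- (t :+ s) :* (t :* t :+ s :* s) :+ (t :+ s) :* c)) refl s t L S (α ℚ.* β))
      where
      open +-*-Solver
      K = (t ℚ.+ s) ℚ.* (t ℚ.* t ℚ.+ s ℚ.* s)
      0≤s = ℚ.≤-trans 0≤1 1≤s
      0≤t = ℚ.≤-trans 0≤s s≤t
      s≤U = ℚ.≤-trans s≤t t≤U
      K≤L : K ℚ.≤ L
      K≤L = *-mono-≤ (0≤+ 0≤t 0≤s) (0≤+ (0≤* 0≤t 0≤t) (0≤* 0≤s 0≤s)) (ℚ.+-mono-≤ t≤U s≤U)
        (ℚ.+-mono-≤ (*-mono-≤ 0≤t 0≤t t≤U t≤U) (*-mono-≤ 0≤s 0≤s s≤U s≤U))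

    0≤L : 0ℚ ℚ.≤ L
    0≤L = 0≤* (0≤+ 0≤U 0≤U) (0≤+ (0≤* 0≤U 0≤U) (0≤* 0≤U 0≤U))

  open Bisection f 1ℚ U L 1≤U 0≤L f-1 f-U f-lipschitz
    using (root; a≤upper; upper≤b; 0≤f-upper; null-f-upper)

  private
    instance
      pos-U : Positive U
      pos-U = ℚ.positive (ℚ.<-≤-trans (ℚ.positive⁻¹ 1ℚ) 1≤U)
      pos-U² : Positive (U ℚ.* U)
      pos-U² = ℚ.pos*pos⇒pos U U

    δ-exists : ∃[ δ ] Positive δ × (U ℚ.* U) ℚ.* δ ≡ 1ℚ
    δ-exists = divide 1ℚ (U ℚ.* U)

    δ : ℚ
    δ = proj₁ δ-exists

    instance
      pos-δ : Positive δ
      pos-δ = proj₁ (proj₂ δ-exists)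

    0≤δ : 0ℚ ℚ.≤ δ
    0≤δ = ℚ.<⇒≤ (ℚ.positive⁻¹ δ)

    U²δ≡1 : (U ℚ.* U) ℚ.* δ ≡ 1ℚ
    U²δ≡1 = proj₂ (proj₂ δ-exists)

    δ≤1 : δ ℚ.≤ 1ℚ
    δ≤1 = subst₂ ℚ._≤_ (ℚ.*-identityˡ δ) U²δ≡1
      (ℚ.*-monoʳ-≤-nonNeg δ {{ℚ.nonNegative 0≤δ}} (*-mono-≤ 0≤1 0≤1 1≤U 1≤U))

    -- With μ = t², (μ − 1)(μ − M) = f t + (a + b − 1).
    square-bound : ∀ t → 1ℚ ℚ.≤ t → t ℚ.≤ U → 0ℚ ℚ.≤ f t → cast M ℚ.+ δ ℚ.≤ t ℚ.* t
    square-bound t 1≤t t≤U 0≤ft = by-size (2 ℕ.≤? a + b)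
      where
      open +-*-Solver
      m μ : ℚ
      m = cast M
      μ = t ℚ.* t
      1≤μ : 1ℚ ℚ.≤ μ
      1≤μ = *-mono-≤ 0≤1 0≤1 1≤t 1≤t
      0≤t = ℚ.≤-trans 0≤1 1≤t
      μ≤U² : μ ℚ.≤ U ℚ.* U
      μ≤U² = *-mono-≤ 0≤t 0≤t t≤U t≤U

      factorisation : (μ ℚ.- 1ℚ) ℚ.* (μ ℚ.- m) ≡ f t ℚ.+ (α ℚ.+ β ℚ.- 1ℚ)
      factorisation = trans (cong (λ m → (μ ℚ.- 1ℚ) ℚ.* (μ ℚ.- m)) m≡)
        (solve 3 (λ a b u → (u :- con 1ℚ) :* (u :- (a :+ b :+ a :* b :- con 1ℚ))
          := u :* u :- (a :+ b :+ a :* b) :* u :+ a :* b :+ (a :+ b :- con 1ℚ)) refl α β μ)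
        where
        m≡ : m ≡ S ℚ.- 1ℚ
        m≡ = trans (solve 1 (λ m → m := con 1ℚ :+ m :- con 1ℚ) refl m) (cong (ℚ._- 1ℚ) (sym S≡1+M))

      -- If a + b ≥ 2, the right side of `factorisation` is at least 1, whereas μ < M + δ would
      -- leave the left side at most (μ - 1) δ < U² δ = 1. If a + b = 1, that right side is only f
      -- t, but then M = 0 and δ ≤ 1 ≤ μ.
      by-size : Dec (2 ≤ a + b) → m ℚ.+ δ ℚ.≤ μ
      by-size (no a+b≱2) = ℚ.≤-trans
        (ℚ.+-mono-≤ (ℚ.≤-reflexive (cong cast (M≡0 a b 1≤a+b (ℕ.≤-pred (ℕ.≰⇒> a+b≱2)) product))) δ≤1) 1≤μ
        where
        M≡0 : ∀ a b → 1 ≤ a + b → a + b ≤ 1 → suc a * suc b ≡ 2 + M → M ≡ 0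
        M≡0 zero          zero       ()
        M≡0 zero          (suc zero) _ _ eq = sym (ℕ.suc-injective (ℕ.suc-injective eq))
        M≡0 (suc zero)    zero       _ _ eq = sym (ℕ.suc-injective (ℕ.suc-injective eq))
        M≡0 zero          (suc (suc b)) _ (s≤s ())
        M≡0 (suc zero)    (suc b)    _ (s≤s ())
        M≡0 (suc (suc a)) b          _ (s≤s ())
      by-size (yes 2≤a+b) = ℚ.≮⇒≥ λ μ<m+δ → ℚ.<-irrefl refl (begin-strict
        1ℚ                                ≤⟨ ≤-gap (f t ℚ.+ (α ℚ.+ β ℚ.- cast 2)) (0≤+ 0≤ft (0≤- 2≤α+β))
          (solve 3 (λ f a b → f :+ (a :+ b :- con 1ℚ)
            := con 1ℚ :+ (f :+ (a :+ b :- (con 1ℚ :+ (con 1ℚ :+ con 0ℚ))))) refl (f t) α β) ⟩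
        f t ℚ.+ (α ℚ.+ β ℚ.- 1ℚ)          ≡⟨ factorisation ⟨
        (μ ℚ.- 1ℚ) ℚ.* (μ ℚ.- m)          ≤⟨ ℚ.*-monoˡ-≤-nonNeg (μ ℚ.- 1ℚ) {{ℚ.nonNegative (0≤- 1≤μ)}} (small μ<m+δ) ⟩
        (μ ℚ.- 1ℚ) ℚ.* δ                  <⟨ ℚ.*-monoˡ-<-pos δ μ-1<U² ⟩
        (U ℚ.* U) ℚ.* δ                   ≡⟨ U²δ≡1 ⟩
        1ℚ                                ∎)
        where
        open ℚ.≤-Reasoning
        2≤α+β : cast 2 ℚ.≤ α ℚ.+ β
        2≤α+β = ℚ.≤-trans (cast-mono 2≤a+b) (ℚ.≤-reflexive (cast-+ a b))
        small : μ ℚ.< m ℚ.+ δ → μ ℚ.- m ℚ.≤ δ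
        small μ<m+δ = subst (μ ℚ.- m ℚ.≤_) (solve 2 (λ m d → m :+ d :- m := d) refl m δ)
          (ℚ.+-monoˡ-≤ (ℚ.- m) (ℚ.<⇒≤ μ<m+δ))
        μ-1<U² : μ ℚ.- 1ℚ ℚ.< U ℚ.* U
        μ-1<U² = ℚ.<-≤-trans (subst (μ ℚ.- 1ℚ ℚ.<_) (ℚ.+-identityʳ μ)
          (ℚ.+-monoʳ-< μ (ℚ.negative⁻¹ (ℚ.- 1ℚ)))) μ≤U²

  -- c = t − 2ε for a late term t of the root, with 4 U ε = δ / 2.
  rational-below-root : ∃[ c ] 0ℚ ℚ.≤ c × cast M ℚ.< c ℚ.* c × fromℚ c <ℝ root
  rational-below-root = from-ε (divide (½ ℚ.* δ) (U ℚ.+ U ℚ.+ (U ℚ.+ U)) {{half-pos δ}}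
    {{ℚ.pos+pos⇒pos (U ℚ.+ U) {{ℚ.pos+pos⇒pos U U}} (U ℚ.+ U) {{ℚ.pos+pos⇒pos U U}}}})
    where
    from-ε : (∃[ ε ] Positive ε × (U ℚ.+ U ℚ.+ (U ℚ.+ U)) ℚ.* ε ≡ ½ ℚ.* δ) →
      ∃[ c ] 0ℚ ℚ.≤ c × cast M ℚ.< c ℚ.* c × fromℚ c <ℝ root
    from-ε (ε , pos-ε , 4Uε≡½δ) = c , 0≤c , M<c² , ε , pos-ε , N , below
      where
      open +-*-Solver
      instance _ = pos-ε
      0≤ε = ℚ.<⇒≤ (ℚ.positive⁻¹ ε)
      N = proj₁ (cauchy root ε)
      t c : ℚ
      t = seq root N
      c = t ℚ.- (ε ℚ.+ ε)

      4Uε : ℚ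
      4Uε = (U ℚ.+ U ℚ.+ (U ℚ.+ U)) ℚ.* ε

      4Uε<δ : 4Uε ℚ.< δ
      4Uε<δ = subst₂ ℚ._<_ (trans (ℚ.+-identityʳ _) (sym 4Uε≡½δ)) (½+½ δ)
        (ℚ.+-monoʳ-< (½ ℚ.* δ) (ℚ.positive⁻¹ (½ ℚ.* δ) {{half-pos δ}}))

      4tε≤4Uε : (t ℚ.+ t ℚ.+ (t ℚ.+ t)) ℚ.* ε ℚ.≤ 4Uε
      4tε≤4Uε = ℚ.*-monoʳ-≤-nonNeg ε {{ℚ.nonNegative 0≤ε}} (ℚ.+-mono-≤ (ℚ.+-mono-≤ t≤U t≤U) (ℚ.+-mono-≤ t≤U t≤U))
        where t≤U = upper≤b N

      2ε≤4Uε : ε ℚ.+ ε ℚ.≤ 4Uε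
      2ε≤4Uε = ≤-gap (ε ℚ.+ ε ℚ.+ (S ℚ.+ S ℚ.+ (S ℚ.+ S)) ℚ.* ε)
        (0≤+ (0≤+ 0≤ε 0≤ε) (0≤* (0≤+ (0≤+ 0≤S 0≤S) (0≤+ 0≤S 0≤S)) 0≤ε))
        (solve 2 (λ s e → let u = con 1ℚ :+ s in
          (u :+ u :+ (u :+ u)) :* e := e :+ e :+ (e :+ e :+ (s :+ s :+ (s :+ s)) :* e)) refl S ε)

      0≤c : 0ℚ ℚ.≤ c
      0≤c = 0≤- (ℚ.≤-trans 2ε≤4Uε (ℚ.≤-trans (ℚ.<⇒≤ 4Uε<δ) (ℚ.≤-trans δ≤1 (a≤upper N))))

      M<c² : cast M ℚ.< c ℚ.* c
      M<c² = begin-strict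
        cast M                                  ≡⟨ solve 2 (λ m x → m := m :+ x :- x) refl (cast M) 4Uε ⟩
        cast M ℚ.+ 4Uε ℚ.- 4Uε                  <⟨ ℚ.+-monoˡ-< (ℚ.- 4Uε) (ℚ.+-monoʳ-< (cast M) 4Uε<δ) ⟩
        cast M ℚ.+ δ ℚ.- 4Uε                    ≤⟨ ℚ.+-mono-≤ (square-bound t (a≤upper N) (upper≤b N) (0≤f-upper N)) (ℚ.neg-antimono-≤ 4tε≤4Uε) ⟩
        t ℚ.* t ℚ.- (t ℚ.+ t ℚ.+ (t ℚ.+ t)) ℚ.* ε  ≤⟨ ≤-gap ((ε ℚ.+ ε) ℚ.* (ε ℚ.+ ε)) (0≤square (ε ℚ.+ ε))
          (solve 2 (λ t e → (t :- (e :+ e)) :* (t :- (e :+ e)) := t :* t :- (t :+ t :+ (t :+ t)) :* e :+ (e :+ e) :* (e :+ e)) refl t ε) ⟩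
        c ℚ.* c                                 ∎
        where open ℚ.≤-Reasoning

      -- One ε absorbs the oscillation of the later terms of the root; the other is the gap that
      -- `<ℝ` demands.
      below : ∀ k → N ≤ k → c ℚ.+ ε ℚ.≤ seq root k
      below k N≤k = begin
        c ℚ.+ ε                    ≡⟨ solve 2 (λ t e → t :- (e :+ e) :+ e := t :- e) refl t ε ⟩
        t ℚ.- ε                    ≤⟨ ℚ.+-monoˡ-≤ (ℚ.- ε) (ℚ.<⇒≤ (distance-< {t} {seq root k} (proj₂ (cauchy root ε) N k ℕ.≤-refl N≤k))) ⟩
        seq root k ℚ.+ ε ℚ.- ε     ≡⟨ solve 2 (λ t e → t :+ e :- e := t) refl (seq root k) ε ⟩
        seq root k                 ∎
        where open ℚ.≤-Reasoning

  quartic-root : ∃[ r ] (∀ k → 1ℚ ℚ.≤ seq r k) × Null (λ k → quartic (cast a) (cast b) (seq r k)) ×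
    (∃[ c ] 0ℚ ℚ.≤ c × cast M ℚ.< c ℚ.* c × fromℚ c <ℝ r)
  quartic-root = root , a≤upper , null-f-upper , rational-below-root

-- Isomorphism invariance

≅-sym : ∀ {m n} {G : Graph m} {H : Graph n} → G ≅ H → H ≅ G
≅-sym {H = H} (π , same) = ↔-sym π , λ i j → trans
  (cong₂ (adj H) (sym (inverseʳ π)) (sym (inverseʳ π))) (sym (same (π ⟨$⟩ˡ i) (π ⟨$⟩ˡ j)))

eigenvalue-≅ : ∀ {m n} {G : Graph m} {H : Graph n} → G ≅ H → ∀ r →
  IsEigenvalue (adjacencyMatrix H) r → IsEigenvalue (adjacencyMatrix G) r
eigenvalue-≅ {m} {n} {G} {H} (π , same) r (x , nonzero , eigen) =
  (λ i → x (π ⟨$⟩ʳ i)) , (λ x≃0 → nonzero (λ i → subst (λ j → x j ≃ 0ℝ) (inverseʳ π) (x≃0 (π ⟨$⟩ˡ i)))) ,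
  approximate-eigenvector G r (λ i → x (π ⟨$⟩ʳ i)) (λ k i → v k (π ⟨$⟩ʳ i)) (λ _ _ → refl) residual-null
  where
  v : ℕ → Fin n → ℚ
  v k j = seq (x j) k
  image-π : ∀ u i → image H u (π ⟨$⟩ʳ i) ≡ image G (λ j → u (π ⟨$⟩ʳ j)) i
  image-π u i = trans (ℚΣ⁺.sum-permute (λ j → 𝟙ℚ (adj H (π ⟨$⟩ʳ i) j) ℚ.* u j) π)
    (ℚΣ.sum-cong-≗ (λ j → cong (λ b → 𝟙ℚ b ℚ.* u (π ⟨$⟩ʳ j)) (sym (same i j))))
  residual-null : ∀ i → Null (λ k → image G (λ j → v k (π ⟨$⟩ʳ j)) i ℚ.- seq r k ℚ.* v k (π ⟨$⟩ʳ i))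
  residual-null i = null-cong
    (λ k → cong (ℚ._- seq r k ℚ.* v k (π ⟨$⟩ʳ i)) (sym (image-π (v k) i)))
    (difference-null ((adjacencyMatrix H · x) (π ⟨$⟩ʳ i)) r (x (π ⟨$⟩ʳ i)) (λ k → image H (v k) (π ⟨$⟩ʳ i))
      (seq-adjacency H x (π ⟨$⟩ʳ i)) (eigen (π ⟨$⟩ʳ i)))

spectralRadius-≅ : ∀ {m n} {G : Graph m} {H : Graph n} → G ≅ H → ∀ r s →
  IsSpectralRadius G r → IsSpectralRadius H s → r ≃ s
spectralRadius-≅ {G = G} {H} G≅H r s (r-eigen , r-largest) (s-eigen , s-largest) = ≤-antisym r s
  (s-largest r (eigenvalue-≅ {G = H} {G} (≅-sym {G = G} {H} G≅H) r r-eigen))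
  (r-largest s (eigenvalue-≅ {G = G} {H} G≅H s s-eigen))

-- ρ(G)² ≤ M < ρ(H)².
few-twoWalks⇒≱ : ∀ {m n a b M} {G : Graph m} {H : Graph n} → 1 ≤ a + b → suc a * suc b ≡ 2 + M →
  (∀ i → twoWalks G i ≤ M) → BipartiteMinusEdge H (suc a) (suc b) → ∀ r s →
  IsSpectralRadius G r → IsSpectralRadius H s → ¬ (s ≤ℝ r)
few-twoWalks⇒≱ {a = a} {b} {M} {G} {H} 1≤a+b product walks≤M B r s ((x , nonzero , eigen) , _) (_ , s-largest) s≤r =
  from-root (QuarticRoot.quartic-root a b M 1≤a+b product)
  where
  from-root : ¬ (∃[ t ] (∀ k → 1ℚ ℚ.≤ seq t k) × Null (λ k → quartic (cast a) (cast b) (seq t k)) ×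
    (∃[ c ] 0ℚ ℚ.≤ c × cast M ℚ.< c ℚ.* c × fromℚ c <ℝ t))
  from-root (t , 1≤t , null , c , 0≤c , M<c² , c<t) =
    nonzero (eigenvector-null G M walks≤M r x eigen c 0≤c M<c² (c≤r c<r))
    where
    c<r : fromℚ c <ℝ r
    c<r = <-≤-trans (fromℚ c) s r
      (<-≤-trans (fromℚ c) t s c<t (s-largest t (quartic-root⇒eigenvalue B t 1≤t null))) s≤r
    c≤r : fromℚ c <ℝ r → Eventually (λ k → c ℚ.≤ seq r k)
    c≤r (ε , pos-ε , N , c+ε≤r) = N , λ k N≤k →
      ℚ.≤-trans (≤-gap ε (ℚ.<⇒≤ (ℚ.positive⁻¹ ε {{pos-ε}})) refl) (c+ε≤r k N≤k)

-- Comparison of the two spectral radii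

module _ {n k a b : ℕ} (n≡p+q : n ≡ suc (suc a) + suc b) (halves : Halves (suc (suc a)) (suc b))
  (G : Graph n) (triangle-free : TriangleFree G) (connected : Connected (complement G))
  (K : Graph k) (K-structure : BipartiteMinusEdge K (suc (suc a)) (suc b))
  (ρG ρK : ℝ) (G-radius : IsSpectralRadius G ρG) (K-radius : IsSpectralRadius K ρK) where

  private
    conclude : 0 < n → BipartiteMinusEdge G (suc (suc a)) (suc b) ⊎ (∀ i → 2 + twoWalks G i ≤ suc (suc a) * suc b) →
      (ρG ≤ℝ ρK) × ((ρG ≃ ρK) ⇔ (G ≅ K))
    conclude _ (inj₁ G-structure) = ≃⇒≤ ρG ρK ρG≃ρK , mk⇔ (λ _ → G≅K) (λ _ → ρG≃ρK)
      where
      G≅K : G ≅ K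
      G≅K = isomorphic {G = G} {K} G-structure K-structure
      ρG≃ρK : ρG ≃ ρK
      ρG≃ρK = spectralRadius-≅ {G = G} {K} G≅K ρG ρK G-radius K-radius
    conclude 0<n (inj₂ few) =
      -- Refuting ρK ≤ ρG settles both claims: it contradicts ρK < ρG, and it rules out equality,
      -- which leaves the forward implication vacuous.
      (λ ρK<ρG → ρK≰ρG (<⇒≤ ρK ρG ρK<ρG)) ,
      mk⇔ (λ ρG≃ρK → contradiction (≃⇒≤ ρK ρG (≃-sym ρG ρK ρG≃ρK)) ρK≰ρG)
          (λ G≅K → spectralRadius-≅ {G = G} {K} G≅K ρG ρK G-radius K-radius)
      where
      from-excess : ∀ M → 2 + M ≡ suc (suc a) * suc b → ¬ (ρK ≤ℝ ρG)
      from-excess M eq = few-twoWalks⇒≱ {a = suc a} {b} {M} {G} {K} (s≤s z≤n) (sym eq)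
        (λ i → ℕ.+-cancelˡ-≤ 2 (twoWalks G i) M (ℕ.≤-trans (few i) (ℕ.≤-reflexive (sym eq))))
        K-structure ρG ρK G-radius K-radius
      ρK≰ρG : ¬ (ρK ≤ℝ ρG)
      -- `few` at any one vertex gives 2 ≤ p q, so M = p q - 2 is obtained without truncated
      -- subtraction; the vertex exists because n > 0.
      ρK≰ρG = let M , eq = ℕ.m≤n⇒∃[o]m+o≡n (ℕ.m+n≤o⇒m≤o 2 (few (fromℕ< 0<n))) in from-excess M eq

  spectral-extremal : (ρG ≤ℝ ρK) × ((ρG ≃ ρK) ⇔ (G ≅ K))
  spectral-extremal = conclude (subst (0 <_) (sym n≡p+q) (s≤s z≤n))
    (extremal-or-few-twoWalks n≡p+q halves (s≤s (s≤s z≤n)) (s≤s z≤n) G triangle-free connected)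

corollary4p2 : ∀ (n : ℕ) → 3 ≤ n →
    (G : Graph n) → TriangleFree G → Connected (complement G) →
    (u v : Fin (⌈ n /2⌉ + ⌊ n /2⌋)) → Adj (completeBipartite ⌈ n /2⌉ ⌊ n /2⌋) u v →
    (ρG ρK : ℝ) →
    IsSpectralRadius G ρG →
    IsSpectralRadius (deleteEdge (completeBipartite ⌈ n /2⌉ ⌊ n /2⌋) u v) ρK →
    (ρG ≤ℝ ρK) × ((ρG ≃ ρK) ⇔ (G ≅ deleteEdge (completeBipartite ⌈ n /2⌉ ⌊ n /2⌋) u v))
corollary4p2 1 (s≤s ())
corollary4p2 2 (s≤s (s≤s ()))
-- Exposing three successors makes ⌈n/2⌉ and ⌊n/2⌋ compute to the forms `suc (suc _)` and `suc _`
-- that `spectral-extremal` expects.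
corollary4p2 n@(suc (suc (suc m))) 3≤n G triangle-free connected u v uv =
  spectral-extremal n≡p+q (halves-of n) G triangle-free connected
    (deleteEdge (completeBipartite ⌈ n /2⌉ ⌊ n /2⌋) u v) (bipartiteMinusEdge ⌈ n /2⌉ ⌊ n /2⌋ u v uv)
  where
  n≡p+q : n ≡ ⌈ n /2⌉ + ⌊ n /2⌋
  n≡p+q = sym (trans (ℕ.+-comm ⌈ n /2⌉ ⌊ n /2⌋) (ℕ.⌊n/2⌋+⌈n/2⌉≡n n))
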